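{- Let $G$ be a simple graph, let $l$ be a nonincreasing intersecting supermodular nonnegative integer-valued function on subsets of $V(G)$, and let $p$ and $k$ be positive integers with $k\ge 2$. Suppose that $G$ is $(4kp-2p+2l)$-connected, i.e. for any two disjoint vertex sets $A,B\subseteq V(G)$ with $A\neq\emptyset$ and $A\cup B\subsetneq V(G)$, $$d_{G-B}(A)\ge 4kp-2p+2l(A\cup B)-|B|.$$ Then $G$ has a packing (a collection of pairwise edge-disjoint subgraphs) consisting of one spanning $l$-partition-connected subgraph and $p$ spanning $k$-rigid subgraphs.
   Context: Graphs are finite and loopless; multiple edges are allowed unless the graph is called simple. For $X\subseteq V(G)$, $d_G(X)$ is the number of edges with exactly one end in $X$, $e_G(X)$ the number of edges with both ends in $X$, and $G-B$ is obtained by deleting the vertices of $B$. For a partition $P$ of $V(G)$, $e_G(P)$ is the number of edges joining different parts of $P$. Set functions on subsets of $V(G)$ are zero on $\emptyset$; write $l(v)=l(\{v\})$ and $l(G)=l(V(G))$. A set function $l$ is intersecting supermodular if $l(A\cap B)+l(A\cup B)\ge l(A)+l(B)$ for all $A,B$ with $A\cap B\neq\emptyset$; it is nonincreasing if $l(A)\ge l(B)$ for all nonempty $A\subseteq B$. A graph $H$ is $l$-partition-connected if $e_H(P)\ge\sum_{A\in P}l(A)-l(V(H))$ for every partition $P$ of $V(H)$. For a set function $\ell$, a spanning subgraph $F$ of $H$ is $\ell$-sparse if $e_F(A)\le\sum_{v\in A}\ell(v)-\ell(A)$ for all $A\subseteq V(H)$, and $H$ is $\ell$-rigid if it has a spanning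 $\ell$-sparse subgraph $F$ with $|E(F)|=\sum_{v\in V(H)}\ell(v)-\ell(V(H))$. For an integer $k$, $k$-rigid means $\ell_{k,2k-1}$-rigid, where $\ell_{k,2k-1}$ is $0$ on $\emptyset$, $k$ on singletons and $2k-1$ on sets of at least two vertices. -}

module Defs where

open import Data.Nat using (ℕ; zero; suc; _+_; _*_; _≤_; _<?_)
open import Data.Bool using (Bool; true; false; _∧_; _∨_; not; if_then_else_)
open import Data.Fin using (Fin; toℕ; _≟_)
open import Data.Fin.Subset using (Subset; ⊥; ⊤; ⁅_⁆; _⊆_; _∩_; _∪_; ∣_∣; Nonempty; Empty)
open import Data.List using (List; allFin; map)
open import Data.Nat.ListAction using (sum)
open import Data.Vec using (lookup; tabulate)
open import Data.Product using (Σ; ∃; _×_; _,_)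
open import Relation.Binary.PropositionalEquality using (_≡_; _≢_)
open import Relation.Nullary.Decidable using (⌊_⌋)

Σᶠ : ∀ {n} → (Fin n → ℕ) → ℕ
Σᶠ {n} g = sum (map g (allFin n))

_∈ᵇ_ : ∀ {n} → Fin n → Subset n → Bool
i ∈ᵇ A = lookup A i

countPairs : ∀ {n} → (Fin n → Fin n → Bool) → ℕ
countPairs {n} P =
  Σᶠ λ i → Σᶠ λ j → if ⌊ toℕ i <? toℕ j ⌋ ∧ P i j then 1 else 0

-- Graphs on vertex set Fin n, given by a boolean adjacency relation.
-- (Subgraphs of a simple graph are simple, so this suffices.)

Adj : ℕ → Set
Adj n = Fin n → Fin n → Bool

record SimpleGraph (n : ℕ) : Set where
  field
    adj   : Adj n
    sym   : ∀ i j → adj i j ≡ adj j i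
    irrefl : ∀ i → adj i i ≡ false
open SimpleGraph public

_⊑_ : ∀ {n} → SimpleGraph n → SimpleGraph n → Set
H ⊑ G = ∀ i j → adj H i j ≡ true → adj G i j ≡ true

EdgeDisjoint : ∀ {n} → SimpleGraph n → SimpleGraph n → Set
EdgeDisjoint H K = ∀ i j → adj H i j ≡ true → adj K i j ≡ false

numEdges : ∀ {n} → SimpleGraph n → ℕ
numEdges H = countPairs (adj H)

eIn : ∀ {n} → SimpleGraph n → Subset n → ℕ
eIn H A = countPairs λ i j → adj H i j ∧ (i ∈ᵇ A) ∧ (j ∈ᵇ A)

dMinus : ∀ {n} → SimpleGraph n → Subset n → Subset n → ℕ
dMinus G B A = countPairs λ i j →
  adj G i j ∧ ((i ∈ᵇ A ∧ out j) ∨ (out i ∧ j ∈ᵇ A))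
  where
  out : _ → Bool
  out v = not (v ∈ᵇ A) ∧ not (v ∈ᵇ B)

SetFun : ℕ → Set
SetFun n = Subset n → ℕ

IntersectingSupermodular : ∀ {n} → SetFun n → Set
IntersectingSupermodular l =
  ∀ A B → Nonempty (A ∩ B) → l A + l B ≤ l (A ∩ B) + l (A ∪ B)

Nonincreasing : ∀ {n} → SetFun n → Set
Nonincreasing l = ∀ A B → Nonempty A → A ⊆ B → l B ≤ l A

-- Partitions of Fin n: a surjection f : Fin n → Fin m; the parts are the
-- (nonempty) fibres f⁻¹(c), c : Fin m.

record Partition (n : ℕ) : Set where
  field
    size  : ℕ
    block : Fin n → Fin size
    surj  : ∀ c → ∃ λ i → block i ≡ c
open Partition public

part : ∀ {n} → (P : Partition n) → Fin (size P) → Subset n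
part P c = tabulate λ i → ⌊ block P i ≟ c ⌋

eCross : ∀ {n} → SimpleGraph n → Partition n → ℕ
eCross H P = countPairs λ i j → adj H i j ∧ not ⌊ block P i ≟ block P j ⌋

-- H is l-partition-connected:  e_H(P) ≥ Σ_{A∈P} l(A) − l(V(H))
-- (written additively over ℕ)
PartitionConnected : ∀ {n} → SetFun n → SimpleGraph n → Set
PartitionConnected {n} l H =
  ∀ (P : Partition n) → Σᶠ (λ c → l (part P c)) ≤ eCross H P + l ⊤

sumSingletons : ∀ {n} → SetFun n → Subset n → ℕ
sumSingletons ℓ A = Σᶠ λ v → if v ∈ᵇ A then ℓ ⁅ v ⁆ else 0

-- F is ℓ-sparse:  e_F(A) ≤ Σ_{v∈A} ℓ(v) − ℓ(A) for all A (additively)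
Sparse : ∀ {n} → SetFun n → SimpleGraph n → Set
Sparse ℓ F = ∀ A → eIn F A + ℓ A ≤ sumSingletons ℓ A

Rigid : ∀ {n} → SetFun n → SimpleGraph n → Set
Rigid ℓ H = Σ _ λ F → F ⊑ H × Sparse ℓ F × (numEdges F + ℓ ⊤ ≡ sumSingletons ℓ ⊤)

ℓk : ∀ {n} → ℕ → SetFun n
ℓk k A with ∣ A ∣
... | zero = 0
... | suc zero = k
... | suc (suc _) = k + k Data.Nat.∸ 1

KRigid : ∀ {n} → ℕ → SimpleGraph n → Set
KRigid k H = Rigid (ℓk k) H

-- (4kp − 2p + 2l)-connectivity: for disjoint A, B with A ≠ ∅ and A ∪ B ≠ V,
--   d_{G-B}(A) ≥ 4kp − 2p + 2 l(A ∪ B) − |B|   (written additively)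
Connected4kp : ∀ {n} → ℕ → ℕ → SetFun n → SimpleGraph n → Set
Connected4kp k p l G =
  ∀ A B → Nonempty A → Empty (A ∩ B) → A ∪ B ≢ ⊤ →
  4 * k * p + 2 * l (A ∪ B) ≤ dMinus G B A + ∣ B ∣ + 2 * p

{-# OPTIONS --safe #-}

-- Work in the union of the l-sparsity matroid and p copies of the (k, 2k-1)-sparsity matroid on E(G).
-- By submodularity of the rank functions (Rado's argument), disjoint bases of full rank exist as soon as
-- |E \ R| + r_l(R) + p r_k(R) is at least the sum of the full ranks for every R ⊆ E.  The ranks are read
-- off tight vertex sets: r_l(R) gives a partition P of V, r_k(R) a family C, with every edge of R that is
-- not counted individually lying in a member of both.  Intersect the members of C with the parts of P and
-- drop pieces with fewer than 2pk vertices: as G is simple, their edges may be counted individually instead.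
-- For a piece X with a vertex in no other piece, apply the connectivity to A = these private vertices and
-- B = the other vertices of X: the edges leaving A outside X pay for 4kp - 2p + 2 l(X) - |B|.  Uncovered
-- vertices, and parts all of whose vertices lie in two pieces, are treated likewise.  Each edge pays at
-- most twice, and as pieces are large the shared vertices make up for the remaining deficit.

module Submission where

open import Defs renaming (sym to adj-sym)
open import Data.Bool using (Bool; true; false; _∧_; _∨_; not; if_then_else_)
open import Data.Bool.Properties using (¬-not)
import Data.Bool.Properties as Bool
open import Data.Fin using (Fin; zero; suc; toℕ; _≟_; punchIn; punchOut; splitAt; _↑ˡ_; _↑ʳ_; combine; quotient; remainder)
open import Data.Fin.Properties using (any?; suc-injective; remQuot-combine; combine-remQuot; punchIn-punchOut; splitAt-↑ˡ; splitAt-↑ʳ)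
open import Data.Fin.Subset using (Subset; ⊥; ⊤; ⁅_⁆; _∈_; _∉_; _⊆_; _∩_; _∪_; ∣_∣; Nonempty; Empty)
open import Data.Fin.Subset.Properties using (anySubset?; ∪-identityʳ; nonempty?; _∈?_; x∈⁅x⁆; x∈⁅y⁆⇒x≡y; ∣⁅x⁆∣≡1; ∣⊥∣≡0; ∣⊤∣≡n; p⊆q⇒∣p∣≤∣q∣; p⊆p∪q; q⊆p∪q; p∩q⊆p; p∩q⊆q; x∈p∩q⁺; x∈p∩q⁻; x∈p∪q⁻; ∈⊤; ∉⊥; ⊆-antisym; ⊆⊤; ⊆-refl; ⊆-trans)
import Data.List as List
open import Data.List.Properties using (map-tabulate)
open import Data.Nat using (ℕ; zero; suc; _+_; _*_; _∸_; _≤_; _<_; z≤n; s≤s; s≤s⁻¹; _≤?_; _<?_) renaming (_≟_ to _≟ℕ_)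
import Data.Nat.ListAction as ListAction
open import Data.Nat.Properties hiding (_≟_; suc-injective)
open import Data.Nat.Tactic.RingSolver using (solve-∀)
open import Data.Product using (Σ; ∃; ∃₂; _×_; _,_; proj₁; proj₂)
open import Data.Sum using (_⊎_; inj₁; inj₂)
open import Data.Vec using (lookup; tabulate; _∷_; [])
open import Data.Vec.Properties using (lookup-zipWith; lookup∘tabulate; lookup-replicate; []=⇒lookup; lookup⇒[]=; ≡-dec)
open import Function using (_∘_)
open import Relation.Binary.PropositionalEquality using (_≡_; _≢_; refl; sym; trans; cong; cong₂; subst; subst₂; module ≡-Reasoning)
open import Relation.Nullary using (¬_; Dec; yes; no; contradiction)
open import Relation.Nullary.Decidable using (⌊_⌋; ¬?; _×-dec_; decidable-stable)
import Algebra.Properties.Semiring.Sum +-*-semiring as Sum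

-- Sums and counting

-- Counts are doubled, so that an edge outside the pieces can give one unit to each end. In these
-- units a piece `X` is worth 2p(k|X| - 2k + 1), that is, 2pk for each of its vertices less a
-- deficit 4kp - 2p, the constant of the connectivity hypothesis. The obstacle is that pieces may
-- overlap: connectivity guarantees edges only at private vertices and loses one for every shared
-- vertex. The threshold 2pk is balanced between two needs. Below it, x(x - 1) <= 2p(kx - 2k + 1)
-- for x >= 2, so the worth of a dropped piece pays for its edges. From it on, two units from every
-- vertex exceed the deficit, which settles pieces without private vertices. A vertex in c >= 2
-- pieces can afford this: it is handed 2pkc, keeps 2pk, and 2pk(c - 1) >= 2c because pk >= 2. The
-- matroid axioms are not assumed either: a family of tight sets certifies that a maximal
-- independent set is maximum.

private variable
  m n c : ℕ

𝟙 : Bool → ℕ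
𝟙 b = if b then 1 else 0

𝟙≤1 : ∀ b → 𝟙 b ≤ 1
𝟙≤1 true = ≤-refl
𝟙≤1 false = z≤n

𝟙-mono : ∀ {a b} → (a ≡ true → b ≡ true) → 𝟙 a ≤ 𝟙 b
𝟙-mono {false} _ = z≤n
𝟙-mono {true} h rewrite h refl = ≤-refl

∧-intro : ∀ {a b} → a ≡ true → b ≡ true → a ∧ b ≡ true
∧-intro refl refl = refl

∧-fst : ∀ {a b} → a ∧ b ≡ true → a ≡ true
∧-fst {true} _ = refl

∧-snd : ∀ {a b} → a ∧ b ≡ true → b ≡ true
∧-snd {true} h = h

false≢true : ∀ {a} → a ≡ false → a ≢ true
false≢true refl ()

⌊⌋-true : ∀ {A : Set} (d : Dec A) → ⌊ d ⌋ ≡ true → A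
⌊⌋-true (yes a) _ = a

⌊⌋-true⁺ : ∀ {A : Set} (d : Dec A) → A → ⌊ d ⌋ ≡ true
⌊⌋-true⁺ (yes _) _ = refl
⌊⌋-true⁺ (no na) a = contradiction a na

-- The certificate form of a linear deduction: b − a = (y − x) + s.
≤-from : ∀ {x y a b} s → x ≤ y → b + x ≡ a + y + s → a ≤ b
≤-from {x} {y} {a} {b} s x≤y eq = +-cancelʳ-≤ y a b (begin
  a + y      ≤⟨ m≤m+n (a + y) s ⟩
  a + y + s  ≡⟨ eq ⟨
  b + x      ≤⟨ +-monoʳ-≤ b x≤y ⟩
  b + y      ∎)
  where open ≤-Reasoning

-- Opaque so that the summand can be inferred by unification.
opaque
  sum : (Fin n → ℕ) → ℕ
  sum = Sum.sum

opaque
  unfolding sum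

  sum≡Σᶠ : (f : Fin n → ℕ) → sum f ≡ Σᶠ f
  sum≡Σᶠ {n} f = trans (go n f) (cong ListAction.sum (sym (map-tabulate (λ i → i) f)))
    where
    go : ∀ n (f : Fin n → ℕ) → Sum.sum f ≡ ListAction.sum (List.tabulate f)
    go zero f = refl
    go (suc n) f = cong (f zero +_) (go n (f ∘ suc))

  sum-cons : (f : Fin (suc n) → ℕ) → sum f ≡ f zero + sum (f ∘ suc)
  sum-cons f = refl

  sum-cong : {f g : Fin n → ℕ} → (∀ i → f i ≡ g i) → sum f ≡ sum g
  sum-cong = Sum.sum-cong-≗

  sum-+ : (f g : Fin n → ℕ) → sum (λ i → f i + g i) ≡ sum f + sum g
  sum-+ = Sum.∑-distrib-+

  sum-swap : (f : Fin m → Fin n → ℕ) → sum (λ i → sum (f i)) ≡ sum (λ j → sum λ i → f i j)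
  sum-swap = Sum.∑-comm

  sum-*ˡ : (x : ℕ) (f : Fin n → ℕ) → x * sum f ≡ sum (λ i → x * f i)
  sum-*ˡ = Sum.*-distribˡ-sum

  sum-mono : {f g : Fin n → ℕ} → (∀ i → f i ≤ g i) → sum f ≤ sum g
  sum-mono {zero} h = z≤n
  sum-mono {suc n} h = +-mono-≤ (h zero) (sum-mono (h ∘ suc))

  ≤-sum : (f : Fin n → ℕ) (i : Fin n) → f i ≤ sum f
  ≤-sum f zero = m≤m+n _ _
  ≤-sum f (suc i) = ≤-trans (≤-sum (f ∘ suc) i) (m≤n+m _ _)

  sum-zero : {f : Fin n → ℕ} → (∀ i → f i ≡ 0) → sum f ≡ 0
  sum-zero {n} h = trans (Sum.sum-cong-≗ h) (Sum.sum-replicate-zero n)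

  sum-const : ∀ n x → sum {n} (λ _ → x) ≡ n * x
  sum-const zero x = refl
  sum-const (suc n) x = cong (x +_) (sum-const n x)

  sum-𝟙-unique : (f : Fin n → Bool) → (∀ x y → f x ≡ true → f y ≡ true → x ≡ y) → sum (𝟙 ∘ f) ≤ 1
  sum-𝟙-unique {zero} f u = z≤n
  sum-𝟙-unique {suc n} f u with f zero in eq
  ... | false = sum-𝟙-unique (f ∘ suc) λ x y p q → suc-injective (u (suc x) (suc y) p q)
  ... | true = ≤-reflexive (cong suc (sum-zero rest))
    where
    rest : ∀ i → 𝟙 (f (suc i)) ≡ 0
    rest i with f (suc i) in eq′
    ... | false = refl
    ... | true with () ← u zero (suc i) eq eq′

  sum-squeeze : {f g : Fin n → ℕ} → (∀ i → f i ≤ g i) → sum g ≤ sum f → ∀ i → g i ≤ f i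
  sum-squeeze {suc n} {f} {g} h s zero =
    +-cancelʳ-≤ (sum (f ∘ suc)) _ _ (≤-trans (+-monoʳ-≤ (g zero) (sum-mono (h ∘ suc))) s)
  sum-squeeze {suc n} {f} {g} h s (suc i) =
    sum-squeeze (h ∘ suc) (+-cancelˡ-≤ (f zero) _ _ (≤-trans (+-monoˡ-≤ _ (h zero)) s)) i

sum-if : ∀ b (f : Fin n → ℕ) → sum (λ i → if b then f i else 0) ≡ (if b then sum f else 0)
sum-if true f = refl
sum-if false f = sum-zero λ _ → refl

cnt : (Fin m → Bool) → ℕ
cnt J = sum (𝟙 ∘ J)

cnt-mono : {I J : Fin m → Bool} → (∀ e → I e ≡ true → J e ≡ true) → cnt I ≤ cnt J
cnt-mono h = sum-mono λ e → 𝟙-mono (h e)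

cnt≤size : (J : Fin m → Bool) → cnt J ≤ m
cnt≤size {m} J = ≤-trans (sum-mono λ e → 𝟙≤1 (J e)) (≤-reflexive (trans (sum-const m 1) (*-identityʳ m)))

-- Sums over subsets

sumOver : Subset n → (Fin n → ℕ) → ℕ
sumOver A f = sum λ v → if v ∈ᵇ A then f v else 0

∈⇒∈ᵇ : {A : Subset n} {v : Fin n} → v ∈ A → v ∈ᵇ A ≡ true
∈⇒∈ᵇ = []=⇒lookup

∈ᵇ⇒∈ : {A : Subset n} {v : Fin n} → v ∈ᵇ A ≡ true → v ∈ A
∈ᵇ⇒∈ {A = A} {v} = lookup⇒[]= v A

∈ᵇ-⊆ : {A B : Subset n} {v : Fin n} → A ⊆ B → v ∈ᵇ A ≡ true → v ∈ᵇ B ≡ true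
∈ᵇ-⊆ s h = ∈⇒∈ᵇ (s (∈ᵇ⇒∈ h))

∈ᵇ-∩ : (v : Fin n) (A B : Subset n) → v ∈ᵇ (A ∩ B) ≡ v ∈ᵇ A ∧ v ∈ᵇ B
∈ᵇ-∩ v = lookup-zipWith _∧_ v

∈ᵇ-∪ : (v : Fin n) (A B : Subset n) → v ∈ᵇ (A ∪ B) ≡ v ∈ᵇ A ∨ v ∈ᵇ B
∈ᵇ-∪ v = lookup-zipWith _∨_ v

∈ᵇ-⊤ : (v : Fin n) → v ∈ᵇ ⊤ ≡ true
∈ᵇ-⊤ v = lookup-replicate v true

∈ᵇ-⊥ : (v : Fin n) → v ∈ᵇ ⊥ ≡ false
∈ᵇ-⊥ v = lookup-replicate v false

opaque
  unfolding sum

  card : (A : Subset n) → ∣ A ∣ ≡ sumOver A (λ _ → 1)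
  card [] = refl
  card (true ∷ A) = cong suc (card A)
  card (false ∷ A) = card A

sumOver-mono : (A : Subset n) {f g : Fin n → ℕ} → (∀ v → v ∈ᵇ A ≡ true → f v ≤ g v) → sumOver A f ≤ sumOver A g
sumOver-mono A {f} {g} h = sum-mono pt
  where
  pt : ∀ v → (if v ∈ᵇ A then f v else 0) ≤ (if v ∈ᵇ A then g v else 0)
  pt v with v ∈ᵇ A in eq
  ... | true = h v eq
  ... | false = z≤n

sumOver-distrib-+ : (A : Subset n) (f g : Fin n → ℕ) → sumOver A (λ v → f v + g v) ≡ sumOver A f + sumOver A g
sumOver-distrib-+ A f g = trans (sum-cong pt) (sum-+ _ _)
  where
  pt : ∀ v → (if v ∈ᵇ A then f v + g v else 0) ≡ (if v ∈ᵇ A then f v else 0) + (if v ∈ᵇ A then g v else 0)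
  pt v with v ∈ᵇ A
  ... | true = refl
  ... | false = refl

opaque
  unfolding sum

  sumOver-const : (A : Subset n) (x : ℕ) → sumOver A (λ _ → x) ≡ x * ∣ A ∣
  sumOver-const [] x = sym (*-zeroʳ x)
  sumOver-const (true ∷ A) x = trans (cong (x +_) (sumOver-const A x)) (sym (*-suc x ∣ A ∣))
  sumOver-const (false ∷ A) x = sumOver-const A x

sumOver-∈ : (A : Subset n) (f : Fin n → ℕ) {v : Fin n} → v ∈ᵇ A ≡ true → f v ≤ sumOver A f
sumOver-∈ A f {v} h = subst (_≤ sumOver A f) (cong (if_then f v else 0) h) (≤-sum _ v)

opaque
  unfolding sum

  sumOver-⁅⁆ : (v : Fin n) (f : Fin n → ℕ) → sumOver ⁅ v ⁆ f ≡ f v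
  sumOver-⁅⁆ {suc n} zero f =
    trans (cong (f zero +_) (sum-zero λ u → cong (if_then f (suc u) else 0) (∈ᵇ-⊥ u))) (+-identityʳ _)
  sumOver-⁅⁆ {suc n} (suc v) f = sumOver-⁅⁆ v (f ∘ suc)

sumOver-⊤ : (f : Fin n → ℕ) → sumOver ⊤ f ≡ sum f
sumOver-⊤ f = sum-cong λ v → cong (if_then f v else 0) (∈ᵇ-⊤ v)

sumOver-⊥ : (f : Fin n → ℕ) → sumOver ⊥ f ≡ 0
sumOver-⊥ f = sum-zero λ v → cong (if_then f v else 0) (∈ᵇ-⊥ v)

sumOver-modular : (A B : Subset n) (f : Fin n → ℕ) →
  sumOver (A ∩ B) f + sumOver (A ∪ B) f ≡ sumOver A f + sumOver B f
sumOver-modular A B f = trans (sym (sum-+ _ _)) (trans (sum-cong pt) (sum-+ _ _))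
  where
  pt : ∀ v → (if v ∈ᵇ (A ∩ B) then f v else 0) + (if v ∈ᵇ (A ∪ B) then f v else 0)
           ≡ (if v ∈ᵇ A then f v else 0) + (if v ∈ᵇ B then f v else 0)
  pt v rewrite ∈ᵇ-∩ v A B | ∈ᵇ-∪ v A B with v ∈ᵇ A | v ∈ᵇ B
  ... | true | true = refl
  ... | true | false = sym (+-identityʳ _)
  ... | false | true = refl
  ... | false | false = refl

card-modular : (A B : Subset n) → ∣ A ∩ B ∣ + ∣ A ∪ B ∣ ≡ ∣ A ∣ + ∣ B ∣
card-modular A B rewrite card (A ∩ B) | card (A ∪ B) | card A | card B = sumOver-modular A B _

multiplicity : (Fin c → Subset n) → Fin n → ℕ
multiplicity X u = sum λ x → 𝟙 (u ∈ᵇ X x)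

double-count : (X : Fin c → Subset n) (f : Fin n → ℕ) →
  sum (λ x → sumOver (X x) f) ≡ sum (λ u → multiplicity X u * f u)
double-count X f = trans (sum-swap _) (sum-cong λ u → pt u)
  where
  scale : ∀ b x → (if b then x else 0) ≡ x * 𝟙 b
  scale true x = sym (*-identityʳ x)
  scale false x = sym (*-zeroʳ x)
  pt : ∀ u → sum (λ x → if u ∈ᵇ X x then f u else 0) ≡ multiplicity X u * f u
  pt u = trans (sum-cong λ x → scale (u ∈ᵇ X x) (f u))
    (trans (sym (sum-*ˡ (f u) _)) (*-comm (f u) _))

multiplicity≤1 : (X : Fin c → Subset n) (u : Fin n) →
  (∀ x y → u ∈ᵇ X x ≡ true → u ∈ᵇ X y ≡ true → x ≡ y) → multiplicity X u ≤ 1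
multiplicity≤1 X u = sum-𝟙-unique λ x → u ∈ᵇ X x

1≤multiplicity : (X : Fin c → Subset n) (u : Fin n) (x : Fin c) → u ∈ᵇ X x ≡ true → 1 ≤ multiplicity X u
1≤multiplicity X u x h = subst (_≤ multiplicity X u) (cong 𝟙 h) (≤-sum _ x)

opaque
  unfolding sum

  1≤sum⇒∃ : (f : Fin n → Bool) → 1 ≤ sum (𝟙 ∘ f) → ∃ λ i → f i ≡ true
  1≤sum⇒∃ {suc n} f h with f zero in eq
  ... | true = zero , eq
  ... | false with i , p ← 1≤sum⇒∃ (f ∘ suc) h = suc i , p

  sum-𝟙≤1⇒unique : (f : Fin n → Bool) → sum (𝟙 ∘ f) ≤ 1 → ∀ x y → f x ≡ true → f y ≡ true → x ≡ y
  sum-𝟙≤1⇒unique f h zero zero p q = refl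
  sum-𝟙≤1⇒unique f h zero (suc y) p q rewrite p =
    contradiction (≤-trans (subst (_≤ sum (𝟙 ∘ f ∘ suc)) (cong 𝟙 q) (≤-sum _ y)) (s≤s⁻¹ h)) λ ()
  sum-𝟙≤1⇒unique f h (suc x) zero p q rewrite q =
    contradiction (≤-trans (subst (_≤ sum (𝟙 ∘ f ∘ suc)) (cong 𝟙 p) (≤-sum _ x)) (s≤s⁻¹ h)) λ ()
  sum-𝟙≤1⇒unique f h (suc x) (suc y) p q =
    cong suc (sum-𝟙≤1⇒unique (f ∘ suc) (≤-trans (m≤n+m _ _) h) x y p q)

-- Sparsity matroids

addTo : (Fin m → Bool) → Fin m → Fin m → Bool
addTo J e f = J f ∨ f ∈ᵇ ⁅ e ⁆

addTo-inv : (J : Fin m → Bool) (e f : Fin m) → addTo J e f ≡ true → J f ≡ true ⊎ f ≡ e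
addTo-inv J e f h with J f
... | true = inj₁ refl
... | false = inj₂ (x∈⁅y⁆⇒x≡y e (∈ᵇ⇒∈ h))

cnt-addTo : (J : Fin m → Bool) (e : Fin m) → J e ≡ false → suc (cnt J) ≤ cnt (addTo J e)
cnt-addTo J e Je = subst (_≤ cnt (addTo J e)) (trans (sum-+ _ _) (trans (cong (cnt J +_) (sumOver-⁅⁆ e _)) (+-comm _ 1)))
  (sum-mono pt)
  where
  pt : ∀ f → 𝟙 (J f) + (if f ∈ᵇ ⁅ e ⁆ then 1 else 0) ≤ 𝟙 (addTo J e f)
  pt f with J f in Jf | f ∈ᵇ ⁅ e ⁆ in eq
  ... | false | true = ≤-refl
  ... | false | false = ≤-refl
  ... | true | false = ≤-refl
  ... | true | true with refl ← x∈⁅y⁆⇒x≡y e (∈ᵇ⇒∈ eq) = contradiction Jf (false≢true Je)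

-- A count matroid in the abstract. `Touch` is the amount of overlap under which `b` is submodular:
-- one common vertex for `l`, two for (k, 2k-1). Since `b` vanishes on singletons, these are always
-- tight, which later lets a cover contain every vertex.
module Sparsity {m n : ℕ} (inside : Fin m → Subset n → Bool) (b : Subset n → ℕ)
  (Touch : Subset n → Subset n → Set) (touch? : ∀ A B → Dec (Touch A B))
  (inside-mono : ∀ e {A B} → A ⊆ B → inside e A ≡ true → inside e B ≡ true)
  (inside-∩ : ∀ e A B → inside e A ≡ true → inside e B ≡ true → inside e (A ∩ B) ≡ true)
  (inside-touch : ∀ e A B → inside e A ≡ true → inside e B ≡ true → Touch A B)
  (b-submod : ∀ A B → Touch A B → b (A ∩ B) + b (A ∪ B) ≤ b A + b B)
  (b-⊥ : b ⊥ ≡ 0) (b-⁅⁆ : ∀ v → b ⁅ v ⁆ ≡ 0)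
  where

  within : (Fin m → Bool) → Subset n → ℕ
  within J A = cnt λ e → J e ∧ inside e A

  Indep : (Fin m → Bool) → Set
  Indep J = ∀ A → within J A ≤ b A

  Tight : (Fin m → Bool) → Subset n → Set
  Tight J A = b A ≤ within J A

  indep-or-violated : ∀ J → Indep J ⊎ ∃ λ A → b A < within J A
  indep-or-violated J with anySubset? (λ A → b A <? within J A)
  ... | yes v = inj₂ v
  ... | no ¬v = inj₁ λ A → ≮⇒≥ λ lt → ¬v (A , lt)

  indep? : ∀ J → Dec (Indep J)
  indep? J with indep-or-violated J
  ... | inj₁ i = yes i
  ... | inj₂ (A , lt) = no λ i → <⇒≱ lt (i A)

  within-mono : ∀ {I J} → (∀ e → I e ≡ true → J e ≡ true) → ∀ A → within I A ≤ within J A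
  within-mono h A = cnt-mono λ e p → ∧-intro (h e (∧-fst p)) (∧-snd p)

  Indep-⊆ : ∀ {I J} → (∀ e → I e ≡ true → J e ≡ true) → Indep J → Indep I
  Indep-⊆ h i A = ≤-trans (within-mono h A) (i A)

  Indep-∅ : Indep λ _ → false
  Indep-∅ A = ≤-trans (≤-reflexive (sum-zero λ _ → refl)) z≤n

  within-addTo : ∀ J e A → within (addTo J e) A ≤ within J A + 𝟙 (inside e A)
  within-addTo J e A = ≤-trans (sum-mono pt)
    (≤-reflexive (trans (sum-+ _ _) (cong (within J A +_) (sumOver-⁅⁆ e _))))
    where
    pt : ∀ f → 𝟙 (addTo J e f ∧ inside f A) ≤ 𝟙 (J f ∧ inside f A) + (if f ∈ᵇ ⁅ e ⁆ then 𝟙 (inside f A) else 0)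
    pt f with J f | f ∈ᵇ ⁅ e ⁆
    ... | true | _ = m≤m+n _ _
    ... | false | true = ≤-refl
    ... | false | false = z≤n

  -- One new element raises a count by at most one, and only for sets that contain it; so a set
  -- violated after adding `e` contains `e` and was tight before.
  dependent⇒tight : ∀ {J} e → Indep J → ¬ Indep (addTo J e) → ∃ λ A → inside e A ≡ true × Tight J A
  dependent⇒tight {J} e i ¬i with indep-or-violated (addTo J e)
  ... | inj₁ i′ = contradiction i′ ¬i
  ... | inj₂ (A , lt) with inside e A in eq | <-≤-trans lt (within-addTo J e A)
  ... | true | lt′ = A , eq , s≤s⁻¹ (subst (b A <_) (+-comm _ 1) lt′)
  ... | false | lt′ =
    contradiction (i A) (<⇒≱ (subst (b A <_) (+-identityʳ _) lt′))

  within-supermod : ∀ J A B → within J A + within J B ≤ within J (A ∩ B) + within J (A ∪ B)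
  within-supermod J A B =
    subst₂ _≤_ (sum-+ _ _) (sum-+ _ _) (sum-mono λ e → pt e)
    where
    pt : ∀ e → 𝟙 (J e ∧ inside e A) + 𝟙 (J e ∧ inside e B) ≤ 𝟙 (J e ∧ inside e (A ∩ B)) + 𝟙 (J e ∧ inside e (A ∪ B))
    pt e with J e
    ... | false = z≤n
    ... | true with inside e A in p | inside e B in q
    ... | false | false = z≤n
    ... | true | false rewrite inside-mono e (p⊆p∪q B) p = m≤n+m _ _
    ... | false | true rewrite inside-mono e (q⊆p∪q A B) q = m≤n+m _ _
    ... | true | true rewrite inside-∩ e A B p q | inside-mono e (p⊆p∪q B) p = ≤-refl

  -- Uncrossing: the counts are supermodular, `b` is submodular on touching sets, and independence
  -- bounds the count of the intersection, so the union has no slack left.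
  Tight-∪ : ∀ {J} → Indep J → ∀ {A B} → Touch A B → Tight J A → Tight J B → Tight J (A ∪ B)
  Tight-∪ {J} i {A} {B} t tA tB = +-cancelˡ-≤ (b (A ∩ B)) _ _ (begin
    b (A ∩ B) + b (A ∪ B)                    ≤⟨ b-submod A B t ⟩
    b A + b B                                ≤⟨ +-mono-≤ tA tB ⟩
    within J A + within J B                  ≤⟨ within-supermod J A B ⟩
    within J (A ∩ B) + within J (A ∪ B)      ≤⟨ +-monoˡ-≤ _ (i (A ∩ B)) ⟩
    b (A ∩ B) + within J (A ∪ B)             ∎)
    where open ≤-Reasoning

  opaque
    -- Recursion on the number of members: while two distinct members `C i` and `C j` touch, `i` is
    -- removed from the index set (`punchIn i` enumerates the rest) and the union takes the place of
    -- `j`.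
    merge : ∀ {c} (Q : Subset n → Set) → (∀ {A B} → Touch A B → Q A → Q B → Q (A ∪ B)) →
      (C : Fin c → Subset n) → (∀ x → Q (C x)) →
      ∃ λ c′ → Σ (Fin c′ → Subset n) λ C′ →
        (∀ y → Q (C′ y)) × (∀ x y → Touch (C′ x) (C′ y) → x ≡ y) × (∀ x → ∃ λ y → C x ⊆ C′ y)
    merge {zero} Q Q-∪ C q = zero , C , q , (λ ()) , λ ()
    merge {suc c} Q Q-∪ C q with any? (λ i → any? λ j → ¬? (i ≟ j) ×-dec touch? (C i) (C j))
    ... | no ¬p = suc c , C , q , (λ x y t → decidable-stable (x ≟ y) λ x≢y → ¬p (x , y , x≢y , t)) , λ x → x , ⊆-refl
    ... | yes (i , j , i≢j , t) =
      let c′ , C′ , q′ , sep , cov = merge Q Q-∪ D qD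
      in c′ , C′ , q′ , sep , λ x →
        let y , C⊆D = toD x ; z , D⊆C′ = cov y in z , ⊆-trans C⊆D D⊆C′
      where
      D : Fin c → Subset n
      D a with punchIn i a ≟ j
      ... | yes _ = C i ∪ C j
      ... | no _ = C (punchIn i a)
      qD : ∀ a → Q (D a)
      qD a with punchIn i a ≟ j
      ... | yes _ = Q-∪ t (q i) (q j)
      ... | no _ = q (punchIn i a)
      D-out : ∀ {x} (i≢x : i ≢ x) → C x ⊆ D (punchOut i≢x)
      D-out {x} i≢x with punchIn i (punchOut i≢x) ≟ j | punchIn-punchOut i≢x
      ... | yes eq | eq′ rewrite trans (sym eq′) eq = q⊆p∪q (C i) (C j)
      ... | no _ | eq′ rewrite eq′ = ⊆-refl
      D-in : C i ⊆ D (punchOut i≢j)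
      D-in with punchIn i (punchOut i≢j) ≟ j
      ... | yes _ = p⊆p∪q (C j)
      ... | no neq = contradiction (punchIn-punchOut i≢j) neq
      toD : ∀ x → ∃ λ y → C x ⊆ D y
      toD x with i ≟ x
      ... | yes refl = punchOut i≢j , D-in
      ... | no i≢x = punchOut i≢x , D-out i≢x

  -- Covers by tight sets

  Maximal : (S J : Fin m → Bool) → Set
  Maximal S J = ∀ e → S e ≡ true → J e ≡ false → ¬ Indep (addTo J e)

  uncovered : ∀ {c} → (Fin m → Bool) → (Fin c → Subset n) → Fin m → Bool
  uncovered S C e = S e ∧ not ⌊ any? (λ x → inside e (C x) Bool.≟ true) ⌋

  -- A dual certificate for the size of `J`: its value is the sum of `b` over the pieces plus the
  -- number of elements of `S` inside no piece.
  record Cover (S J : Fin m → Bool) : Set where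
    field
      size : ℕ
      piece : Fin size → Subset n
      tight : ∀ x → Tight J (piece x)
      separated : ∀ x y → Touch (piece x) (piece y) → x ≡ y
      covers-vertex : ∀ v → ∃ λ x → v ∈ piece x
      covers-edge : ∀ e → S e ≡ true → J e ≡ false → ∃ λ x → inside e (piece x) ≡ true

  cover : ∀ {S J} → Indep J → Maximal S J → Cover S J
  cover {S} {J} i mx = record
    { size = proj₁ M
    ; piece = proj₁ (proj₂ M)
    ; tight = proj₁ (proj₂ (proj₂ M))
    ; separated = proj₁ (proj₂ (proj₂ (proj₂ M)))
    ; covers-vertex = λ v → let y , s = up (m ↑ʳ v) in
        y , s (subst (v ∈_) (sym (cong start (splitAt-↑ʳ m n v))) (x∈⁅x⁆ v))
    ; covers-edge = λ e Se Je → let y , s = up (e ↑ˡ n) in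
        y , inside-mono e s (subst (λ A → inside e A ≡ true) (sym (cong start (splitAt-↑ˡ m e n))) (proj₂ (proj₂ (tightSet e)) Se Je))
    }
    where
    ⊥-tight : Tight J ⊥
    ⊥-tight = subst (_≤ within J ⊥) (sym b-⊥) z≤n
    tightSet : ∀ e → ∃ λ A → Tight J A × (S e ≡ true → J e ≡ false → inside e A ≡ true)
    tightSet e with S e in Se | J e in Je
    ... | true | false = let A , p , t = dependent⇒tight e i (mx e Se Je) in A , t , λ _ _ → p
    ... | true | true = ⊥ , ⊥-tight , λ _ ()
    ... | false | _ = ⊥ , ⊥-tight , λ ()
    -- The family to be merged has one tight set per element, with `⊥` as a harmless default, and
    -- all singletons; the latter make the pieces cover the vertex set.
    start : Fin m ⊎ Fin n → Subset n
    start (inj₁ e) = proj₁ (tightSet e)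
    start (inj₂ v) = ⁅ v ⁆
    start-tight : ∀ s → Tight J (start s)
    start-tight (inj₁ e) = proj₁ (proj₂ (tightSet e))
    start-tight (inj₂ v) = subst (_≤ within J ⁅ v ⁆) (sym (b-⁅⁆ v)) z≤n
    M = merge (Tight J) (Tight-∪ i) (start ∘ splitAt m) (λ x → start-tight (splitAt m x))
    up = proj₂ (proj₂ (proj₂ (proj₂ M)))

  -- Two pieces containing the same element touch, hence coincide, so no element of `J` is counted
  -- in two pieces. An element of `S` inside no piece belongs to `J` by `covers-edge`, so it may be
  -- added to the count.
  cover-lower : ∀ {S J} (K : Cover S J) → (∀ e → J e ≡ true → S e ≡ true) →
    let open Cover K in sum (b ∘ piece) + cnt (uncovered S piece) ≤ cnt J
  cover-lower {S} {J} K J⊆S = begin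
    sum (b ∘ piece) + cnt (uncovered S piece)
      ≤⟨ +-monoˡ-≤ _ (sum-mono tight) ⟩
    sum (λ x → within J (piece x)) + cnt (uncovered S piece)
      ≡⟨ cong (_+ _) (sum-swap _) ⟩
    sum (λ e → sum λ x → 𝟙 (J e ∧ inside e (piece x))) + cnt (uncovered S piece)
      ≡⟨ sum-+ _ _ ⟨
    sum (λ e → sum (λ x → 𝟙 (J e ∧ inside e (piece x))) + 𝟙 (uncovered S piece e))
      ≤⟨ sum-mono pt ⟩
    cnt J ∎
    where
    open ≤-Reasoning
    open Cover K
    pt : ∀ e → sum (λ x → 𝟙 (J e ∧ inside e (piece x))) + 𝟙 (uncovered S piece e) ≤ 𝟙 (J e)
    pt e with J e in Je
    ... | true with any? (λ x → inside e (piece x) Bool.≟ true)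
    ...   | yes _ rewrite Bool.∧-zeroʳ (S e) = ≤-trans (≤-reflexive (+-identityʳ _))
              (sum-𝟙-unique (λ x → inside e (piece x)) λ x y p q → separated x y (inside-touch e _ _ p q))
    ...   | no ¬p rewrite sum-zero {f = λ x → 𝟙 (inside e (piece x))}
                (λ x → cong 𝟙 (¬-not λ p → ¬p (x , p))) = 𝟙≤1 (S e ∧ true)
    pt e | false rewrite sum-zero {Cover.size K} {f = λ _ → 0} (λ _ → refl) with S e in Se
    ... | false = z≤n
    ... | true with any? (λ x → inside e (piece x) Bool.≟ true)
    ...   | yes _ = z≤n
    ...   | no ¬p = contradiction (covers-edge e Se Je) ¬p

  -- Weak duality: neither tightness nor separation of the family enters, only the independence of
  -- `I`.
  cover-upper : ∀ {S I} {c} (C : Fin c → Subset n) → Indep I → (∀ e → I e ≡ true → S e ≡ true) →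
    cnt I ≤ sum (b ∘ C) + cnt (uncovered S C)
  cover-upper {S} {I} C i I⊆S = begin
    cnt I
      ≤⟨ sum-mono pt ⟩
    sum (λ e → sum (λ x → 𝟙 (I e ∧ inside e (C x))) + 𝟙 (uncovered S C e))
      ≡⟨ sum-+ _ _ ⟩
    sum (λ e → sum λ x → 𝟙 (I e ∧ inside e (C x))) + cnt (uncovered S C)
      ≡⟨ cong (_+ _) (sum-swap _) ⟩
    sum (λ x → within I (C x)) + cnt (uncovered S C)
      ≤⟨ +-monoˡ-≤ _ (sum-mono λ x → i (C x)) ⟩
    sum (b ∘ C) + cnt (uncovered S C) ∎
    where
    open ≤-Reasoning
    pt : ∀ e → 𝟙 (I e) ≤ sum (λ x → 𝟙 (I e ∧ inside e (C x))) + 𝟙 (uncovered S C e)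
    pt e with I e in Ie
    ... | false = z≤n
    ... | true with any? (λ x → inside e (C x) Bool.≟ true)
    ...   | yes (x , p) = ≤-trans (subst (_≤ sum (λ y → 𝟙 (inside e (C y)))) (cong 𝟙 p) (≤-sum _ x)) (m≤m+n _ _)
    ...   | no _ rewrite I⊆S e Ie = m≤n+m _ _

  -- The cover of `J` bounds every competitor `I` by the size of `J`; this replaces the exchange
  -- axiom.
  maximal⇒maximum : ∀ {S I J} → Indep J → (∀ e → J e ≡ true → S e ≡ true) → Maximal S J →
    Indep I → (∀ e → I e ≡ true → S e ≡ true) → cnt I ≤ cnt J
  maximal⇒maximum i J⊆S mx i′ I⊆S =
    let K = cover i mx in ≤-trans (cover-upper (Cover.piece K) i′ I⊆S) (cover-lower K J⊆S)

  record Base (S I : Fin m → Bool) : Set where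
    field
      set : Fin m → Bool
      extends : ∀ e → I e ≡ true → set e ≡ true
      subset : ∀ e → set e ≡ true → S e ≡ true
      indep : Indep set
      maximal : Maximal S set

  extend : ∀ S I → Indep I → (∀ e → I e ≡ true → S e ≡ true) → Base S I
  extend S I i I⊆S = go m I i I⊆S (m≤n+m m (cnt I))
    where
    -- The fuel bounds the number of elements missing from `I`. At fuel zero `I` already has `m`
    -- elements, so a further one would be a contradiction.
    go : ∀ fuel I → Indep I → (∀ e → I e ≡ true → S e ≡ true) → m ≤ cnt I + fuel → Base S I
    go fuel I i I⊆S enough with any? (λ e → (S e Bool.≟ true) ×-dec (I e Bool.≟ false) ×-dec indep? (addTo I e))
    ... | no none = record
      { set = I ; extends = λ _ p → p ; subset = I⊆S ; indep = i
      ; maximal = λ e Se Ie i′ → none (e , Se , Ie , i′) }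
    go zero I i I⊆S enough | yes (e , Se , Ie , i′) =
      contradiction (≤-trans (cnt-addTo I e Ie) (cnt≤size (addTo I e)))
        (<⇒≱ (s≤s (subst (m ≤_) (+-identityʳ _) enough)))
    go (suc fuel) I i I⊆S enough | yes (e , Se , Ie , i′) = record
      { set = set ; extends = λ f p → extends f (cong (_∨ f ∈ᵇ ⁅ e ⁆) p)
      ; subset = subset ; indep = indep ; maximal = maximal }
      where
      grow : ∀ f → addTo I e f ≡ true → S f ≡ true
      grow f p with addTo-inv I e f p
      ... | inj₁ q = I⊆S f q
      ... | inj₂ refl = Se
      open Base (go fuel (addTo I e) i′ grow
        (≤-trans enough (≤-trans (≤-reflexive (+-suc _ fuel)) (+-monoˡ-≤ fuel (cnt-addTo I e Ie)))))

  -- Rank functions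

  opaque
    base : ∀ S → Base S λ _ → false
    base S = extend S (λ _ → false) Indep-∅ λ _ ()

  rank : (Fin m → Bool) → ℕ
  rank S = cnt (Base.set (base S))

  Indep⇒≤rank : ∀ {S I} → Indep I → (∀ e → I e ≡ true → S e ≡ true) → cnt I ≤ rank S
  Indep⇒≤rank {S} = maximal⇒maximum indep subset maximal
    where open Base (base S)

  rank-mono : ∀ {S T} → (∀ e → S e ≡ true → T e ≡ true) → rank S ≤ rank T
  rank-mono {S} S⊆T = Indep⇒≤rank indep λ e p → S⊆T e (subset e p)
    where open Base (base S)

  -- A base `J₀` of the intersection is extended to a base `J₁` of the union. An element of `J₀`
  -- lies in both traces of `J₁` on `S` and `T`, any other element of `J₁` in at least one, and each
  -- trace is independent.
  rank-submod : ∀ S T → rank (λ e → S e ∨ T e) + rank (λ e → S e ∧ T e) ≤ rank S + rank T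
  rank-submod S T = begin
    rank (λ e → S e ∨ T e) + cnt (set J₀)
      ≤⟨ +-monoˡ-≤ _ (maximal⇒maximum (indep J₁) (subset J₁) (maximal J₁) (indep (base _)) (subset (base _))) ⟩
    cnt (set J₁) + cnt (set J₀)
      ≡⟨ sum-+ _ _ ⟨
    sum (λ e → 𝟙 (set J₁ e) + 𝟙 (set J₀ e))
      ≤⟨ sum-mono pt ⟩
    sum (λ e → 𝟙 (set J₁ e ∧ S e) + 𝟙 (set J₁ e ∧ T e))
      ≡⟨ sum-+ _ _ ⟩
    cnt (λ e → set J₁ e ∧ S e) + cnt (λ e → set J₁ e ∧ T e)
      ≤⟨ +-mono-≤ (trace S) (trace T) ⟩
    rank S + rank T ∎
    where
    open ≤-Reasoning
    open Base
    J₀ = base λ e → S e ∧ T e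
    J₁ : Base (λ e → S e ∨ T e) (set J₀)
    J₁ = extend _ _ (indep J₀) λ e p → cong (_∨ T e) (∧-fst (subset J₀ e p))
    trace : ∀ U → cnt (λ e → set J₁ e ∧ U e) ≤ rank U
    trace U = Indep⇒≤rank (Indep-⊆ (λ e → ∧-fst) (indep J₁)) λ e → ∧-snd
    crossing : ∀ j₁ j₀ s t → (j₀ ≡ true → j₁ ≡ true) → (j₀ ≡ true → s ∧ t ≡ true) → (j₁ ≡ true → s ∨ t ≡ true) →
      𝟙 j₁ + 𝟙 j₀ ≤ 𝟙 (j₁ ∧ s) + 𝟙 (j₁ ∧ t)
    crossing false false _ _ _ _ _ = z≤n
    crossing false true _ _ h _ _ with () ← h refl
    crossing true true true true _ _ _ = ≤-refl
    crossing true true true false _ h _ with () ← h refl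
    crossing true true false _ _ h _ with () ← h refl
    crossing true false true _ _ _ _ = s≤s z≤n
    crossing true false false true _ _ _ = s≤s z≤n
    crossing true false false false _ _ h with () ← h refl
    pt : ∀ e → 𝟙 (set J₁ e) + 𝟙 (set J₀ e) ≤ 𝟙 (set J₁ e ∧ S e) + 𝟙 (set J₁ e ∧ T e)
    pt e = crossing _ _ _ _ (extends J₁ e) (subset J₀ e) (subset J₁ e)

-- Union of matroids

opaque
  unfolding sum

  sum-strict : {f g : Fin n → ℕ} → (∀ i → f i ≤ g i) → ∀ i → f i < g i → sum f < sum g
  sum-strict h zero lt = +-mono-<-≤ lt (sum-mono (h ∘ suc))
  sum-strict h (suc i) lt = +-mono-≤-< (h zero) (sum-strict (h ∘ suc) i lt)

module Union {m s : ℕ} (r : Fin s → (Fin m → Bool) → ℕ)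
  (r-mono : ∀ i {S T} → (∀ e → S e ≡ true → T e ≡ true) → r i S ≤ r i T)
  (r-submod : ∀ i S T → r i (λ e → S e ∨ T e) + r i (λ e → S e ∧ T e) ≤ r i S + r i T)
  (E : Fin m → Bool) (ρ : ℕ)
  where

  -- For rank functions and `a i` contained in `E`, this bounds the total size of disjoint
  -- independent sets chosen from the `a i`: outside `R` by plain counting, inside `R` by ranks.
  value : (Fin s → Fin m → Bool) → (Fin m → Bool) → ℕ
  value a R = cnt (λ e → E e ∧ not (R e)) + sum (λ i → r i (λ e → a i e ∧ R e))

  Good : (Fin s → Fin m → Bool) → Set
  Good a = ∀ R → ρ ≤ value a R

  good-or-violated : ∀ a → Good a ⊎ ∃ λ R → value a R < ρ
  good-or-violated a with anySubset? (λ R → value a (lookup R) <? ρ)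
  ... | yes (R , lt) = inj₂ (lookup R , lt)
  -- The search runs over boolean vectors. A function `R` agrees with its tabulation only pointwise,
  -- so the bound is carried over by monotonicity of the counts and of `r`.
  ... | no none = inj₁ λ R → ≤-trans (≮⇒≥ λ lt → none (tabulate R , lt))
      (+-mono-≤ (cnt-mono λ e → subst (λ x → E e ∧ not x ≡ true) (lookup∘tabulate R e))
        (sum-mono λ i → r-mono i λ e → subst (λ x → a i e ∧ x ≡ true) (lookup∘tabulate R e)))

  forbid : Fin s → Fin m → (Fin s → Fin m → Bool) → Fin s → Fin m → Bool
  forbid i e a j f = a j f ∧ not (⌊ j ≟ i ⌋ ∧ f ∈ᵇ ⁅ e ⁆)

  forbid-other : ∀ {i e a j f} → a j f ≡ true → j ≢ i ⊎ f ∈ᵇ ⁅ e ⁆ ≡ false → forbid i e a j f ≡ true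
  forbid-other {i} {j = j} p (inj₁ j≢i) rewrite p with j ≟ i
  ... | yes eq = contradiction eq j≢i
  ... | no _ = refl
  forbid-other {i} {j = j} p (inj₂ q) rewrite p | q | Bool.∧-zeroʳ ⌊ j ≟ i ⌋ = refl

  -- On a set avoiding `e` the deletion of `e` has no effect, so there the value is still bounded by
  -- goodness of `a`.
  violated⇒∈ : ∀ {i e a R} → Good a → value (forbid i e a) R < ρ → R e ≡ true
  violated⇒∈ {i} {e} {a} {R} g lt with R e in Re
  ... | true = refl
  ... | false = contradiction (≤-trans (g R) (+-monoʳ-≤ _ (sum-mono λ j → r-mono j λ f p →
      ∧-intro (forbid-other {e = e} {a} (∧-fst p) (inj₂ (other f (∧-snd {a j f} p)))) (∧-snd {a j f} p)))) (<⇒≱ lt)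
    where
    other : ∀ f → R f ≡ true → f ∈ᵇ ⁅ e ⁆ ≡ false
    other f Rf with f ∈ᵇ ⁅ e ⁆ in eq
    ... | false = refl
    ... | true with refl ← x∈⁅y⁆⇒x≡y e (∈ᵇ⇒∈ eq) = contradiction Rf (false≢true Re)

  -- Violating sets R and Q would, by submodularity, make R ∪ Q or (R ∩ Q) - e violate Good a.
  forbid-one : ∀ {a i j} e → Good a → i ≢ j → Good (forbid i e a) ⊎ Good (forbid j e a)
  forbid-one {a} {i} {j} e g i≢j with good-or-violated (forbid i e a) | good-or-violated (forbid j e a)
  ... | inj₁ g′ | _ = inj₁ g′
  ... | inj₂ _ | inj₁ g′ = inj₂ g′
  ... | inj₂ (R , ltR) | inj₂ (Q , ltQ) = contradiction (begin-strict
      ρ + ρ                                            ≤⟨ +-mono-≤ (g U) (g W) ⟩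
      value a U + value a W                            ≡⟨ interchange (cnt (out U)) _ _ _ ⟩
      (cnt (out U) + cnt (out W)) + (sum (λ t → r t (λ f → a t f ∧ U f)) + sum (λ t → r t (λ f → a t f ∧ W f)))
                                                       ≤⟨ +-mono-≤ counts ranks ⟩
      (cnt (out R) + cnt (out Q) + 1) + (sum ranksR + sum ranksQ)
                                                       ≡⟨ regroup (cnt (out R)) _ (sum ranksR) _ ⟩
      suc (value (forbid i e a) R) + value (forbid j e a) Q  <⟨ +-mono-≤-< ltR ltQ ⟩
      ρ + ρ                                            ∎) (<-irrefl refl)
    where
    open ≤-Reasoning
    interchange : ∀ x y z w → (x + y) + (z + w) ≡ (x + z) + (y + w)
    interchange = solve-∀
    regroup : ∀ x y z w → (x + y + 1) + (z + w) ≡ (1 + (x + z)) + (y + w)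
    regroup = solve-∀
    out : (Fin m → Bool) → Fin m → Bool
    out X f = E f ∧ not (X f)
    U W : Fin m → Bool
    U f = R f ∨ Q f
    W f = (R f ∧ Q f) ∧ not (f ∈ᵇ ⁅ e ⁆)
    ranksR ranksQ : Fin s → ℕ
    ranksR t = r t (λ f → forbid i e a t f ∧ R f)
    ranksQ t = r t (λ f → forbid j e a t f ∧ Q f)
    -- The extra 1 pays for `e`, which is taken out of the intersection and so may count outside `W`
    -- while it is in both `R` and `Q`.
    counts : cnt (out U) + cnt (out W) ≤ cnt (out R) + cnt (out Q) + 1
    counts = subst₂ _≤_ (sum-+ _ _)
      (trans (sum-+ _ _) (cong₂ _+_ (sum-+ _ _) (sumOver-⁅⁆ e (λ _ → 1)))) (sum-mono pt)
      where
      pt : ∀ f → 𝟙 (out U f) + 𝟙 (out W f) ≤ (𝟙 (out R f) + 𝟙 (out Q f)) + (if f ∈ᵇ ⁅ e ⁆ then 1 else 0)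
      pt f with E f | R f | Q f | f ∈ᵇ ⁅ e ⁆
      ... | false | _ | _ | _ = z≤n
      ... | true | true | true | true = ≤-refl
      ... | true | true | true | false = ≤-refl
      ... | true | true | false | true = s≤s z≤n
      ... | true | true | false | false = ≤-refl
      ... | true | false | true | true = s≤s z≤n
      ... | true | false | true | false = ≤-refl
      ... | true | false | false | true = s≤s (s≤s z≤n)
      ... | true | false | false | false = ≤-refl
    e∈R = violated⇒∈ g ltR
    e∈Q = violated⇒∈ g ltQ
    ranks : sum (λ t → r t (λ f → a t f ∧ U f)) + sum (λ t → r t (λ f → a t f ∧ W f)) ≤ sum ranksR + sum ranksQ
    ranks = subst₂ _≤_ (sum-+ _ _) (sum-+ _ _) (sum-mono λ t →
      ≤-trans (+-mono-≤ (r-mono t (union t)) (r-mono t (inter t))) (r-submod t _ _))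
      where
      ∨ˡ : ∀ {x y} → x ≡ true → x ∨ y ≡ true
      ∨ˡ refl = refl
      ∨ʳ : ∀ {x y} → y ≡ true → x ∨ y ≡ true
      ∨ʳ {x} refl = Bool.∨-zeroʳ x
      -- The element `e` is deleted at index `i` on the `R` side and at index `j` on the `Q` side.
      -- It lies in both `R` and `Q` and `i ≢ j`, so at every index at least one side retains it.
      union : ∀ t f → a t f ∧ U f ≡ true → (forbid i e a t f ∧ R f) ∨ (forbid j e a t f ∧ Q f) ≡ true
      union t f p with f ∈ᵇ ⁅ e ⁆ in eq
      union t f p | false with R f in Rf | Q f in Qf
      ... | true | _ = ∨ˡ (cong (_∧ true) (∧-intro (∧-fst {a t f} p) (cong not (Bool.∧-zeroʳ _))))
      ... | false | true = ∨ʳ {y = _ ∧ true} (∧-intro (∧-intro (∧-fst {a t f} p) (cong not (Bool.∧-zeroʳ _))) refl)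
      ... | false | false = contradiction (∧-snd {a t f} p) λ ()
      union t f p | true with refl ← x∈⁅y⁆⇒x≡y e (∈ᵇ⇒∈ eq) with t ≟ i
      ... | no _ = ∨ˡ (∧-intro (∧-intro (∧-fst {a t e} p) refl) e∈R)
      ... | yes refl with t ≟ j
      ... | yes t≡j = contradiction t≡j i≢j
      ... | no _ = ∨ʳ {y = (a t e ∧ true) ∧ Q e} (∧-intro (∧-intro (∧-fst {a t e} p) refl) e∈Q)
      inter : ∀ t f → a t f ∧ W f ≡ true → (forbid i e a t f ∧ R f) ∧ (forbid j e a t f ∧ Q f) ≡ true
      inter t f p = ∧-intro
        (∧-intro (forbid-other {i} {e} {a} (∧-fst p) (inj₂ f≢e)) (∧-fst (∧-fst {R f ∧ Q f} (∧-snd {a t f} p))))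
        (∧-intro (forbid-other {j} {e} {a} (∧-fst p) (inj₂ f≢e)) (∧-snd {R f} (∧-fst {R f ∧ Q f} (∧-snd {a t f} p))))
        where
        f≢e : f ∈ᵇ ⁅ e ⁆ ≡ false
        f≢e = Bool.not-injective (∧-snd {R f ∧ Q f} (∧-snd {a t f} p))

  forbid-size : ∀ a i e → a i e ≡ true → sum (λ j → cnt (forbid i e a j)) < sum (λ j → cnt (a j))
  forbid-size a i e p = sum-strict (λ j → cnt-mono λ f → ∧-fst {a j f}) i
    (sum-strict (λ f → 𝟙-mono (∧-fst {a i f})) e strict)
    where
    strict : 𝟙 (forbid i e a i e) < 𝟙 (a i e)
    strict with i ≟ i
    ... | no i≢i = contradiction refl i≢i
    ... | yes _ rewrite p | ∈⇒∈ᵇ (x∈⁅x⁆ e) = ≤-refl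

  DisjointSpanning : (Fin s → Fin m → Bool) → Set
  DisjointSpanning a =
    (∀ i e → a i e ≡ true → E e ≡ true) ×
    (∀ i j e → a i e ≡ true → a j e ≡ true → i ≡ j) ×
    ρ ≤ sum (λ i → r i (a i))

  opaque
    disjoint-spanning : Good (λ _ → E) → ∃ DisjointSpanning
    disjoint-spanning h = go _ (λ _ → E) (λ _ _ p → p) h ≤-refl
      where
      go : ∀ fuel a → (∀ i e → a i e ≡ true → E e ≡ true) → Good a → sum (λ j → cnt (a j)) ≤ fuel → ∃ DisjointSpanning
      go fuel a a⊆E g bound with any? (λ e → any? λ i → any? λ j →
          ¬? (i ≟ j) ×-dec (a i e Bool.≟ true) ×-dec (a j e Bool.≟ true))
      ... | no none = a , a⊆E
        , (λ i j e p q → decidable-stable (i ≟ j) λ i≢j → none (e , i , j , i≢j , p , q))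
        -- With everything chosen as `R`, no element lies outside, and goodness becomes the bound on
        -- the sum of ranks.
        , ≤-trans (g λ _ → true) (+-mono-≤ {y = 0} (≤-reflexive (sum-zero λ e → cong 𝟙 (Bool.∧-zeroʳ (E e))))
            (sum-mono λ i → r-mono i λ e → ∧-fst {a i e}))
      go zero a a⊆E g bound | yes (e , i , j , i≢j , p , q) =
        contradiction (<-≤-trans (forbid-size a i e p) bound) λ ()
      go (suc fuel) a a⊆E g bound | yes (e , i , j , i≢j , p , q) with forbid-one e g i≢j
      ... | inj₁ g′ = go fuel (forbid i e a) (λ t f x → a⊆E t f (∧-fst {a t f} x)) g′
            (s≤s⁻¹ (<-≤-trans (forbid-size a i e p) bound))
      ... | inj₂ g′ = go fuel (forbid j e a) (λ t f x → a⊆E t f (∧-fst {a t f} x)) g′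
            (s≤s⁻¹ (<-≤-trans (forbid-size a j e q) bound))

-- The local counting inequality

-- The sparsity bound for `ℓk k` when k >= 1: truncation yields 0 on the empty set and on
-- singletons, where `ℓk k` equals the sum over the singletons.
bk : ℕ → Subset n → ℕ
bk k A = k * ∣ A ∣ ∸ (k + k ∸ 1)

bk-⊥ : ∀ k → bk {n} k ⊥ ≡ 0
bk-⊥ {n} k rewrite ∣⊥∣≡0 n | *-zeroʳ k = 0∸n≡0 (k + k ∸ 1)

k+k∸1+1 : ∀ {k} → 1 ≤ k → k + k ∸ 1 + 1 ≡ 2 * k
k+k∸1+1 {suc k} _ = solve k
  where
  solve : ∀ k → k + suc k + 1 ≡ 2 * suc k
  solve = solve-∀

bk-exact : ∀ k (A : Subset n) → 1 ≤ k → 2 ≤ ∣ A ∣ → bk k A + (k + k ∸ 1) ≡ k * ∣ A ∣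
bk-exact k A 1≤k 2≤A = m∸n+n≡m (≤-trans (m∸n≤m (k + k) 1) (≤-trans (≤-reflexive (solve k)) (*-monoʳ-≤ k 2≤A)))
  where
  solve : ∀ k → k + k ≡ k * 2
  solve = solve-∀

bk-exact′ : ∀ k (A : Subset n) → 1 ≤ k → 2 ≤ ∣ A ∣ → bk k A + 2 * k ≡ k * ∣ A ∣ + 1
bk-exact′ k A 1≤k 2≤A = begin
  bk k A + 2 * k              ≡⟨ cong (bk k A +_) (k+k∸1+1 1≤k) ⟨
  bk k A + (k + k ∸ 1 + 1)    ≡⟨ +-assoc (bk k A) _ 1 ⟨
  bk k A + (k + k ∸ 1) + 1    ≡⟨ cong (_+ 1) (bk-exact k A 1≤k 2≤A) ⟩
  k * ∣ A ∣ + 1               ∎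
  where open ≡-Reasoning

-- Here c is the number of pieces containing a vertex and z its degree outside the pieces.
charge : ℕ → ℕ → ℕ → ℕ
charge w (suc zero) z = z
charge w _ z = w

charge-mono : ∀ {v w} → v ≤ w → ∀ c z → charge v c z ≤ charge w c z
charge-mono h zero z = h
charge-mono h (suc zero) z = ≤-refl
charge-mono h (suc (suc c)) z = h

charge-≢1 : ∀ w {c} z → c ≢ 1 → charge w c z ≡ w
charge-≢1 w {zero} z h = refl
charge-≢1 w {suc zero} z h = contradiction refl h
charge-≢1 w {suc (suc c)} z h = refl

-- The account of a single part `A`, in doubled units: `X` are its pieces, `z` the degrees outside
-- all pieces and `L` stands for `l A`. The hypotheses `inner` and `single` are what connectivity
-- supplies for a private vertex of a piece and for a vertex in no piece.
module Local {c n : ℕ} (p k : ℕ) (1≤p : 1 ≤ p) (2≤k : 2 ≤ k)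
  (A : Subset n) (X : Fin c → Subset n) (z : Fin n → ℕ) (L : ℕ)
  (X⊆A : ∀ x → X x ⊆ A)
  (large : ∀ x → X x ≡ ⊥ ⊎ 2 * (p * k) ≤ ∣ X x ∣)
  (inner : ∀ x u → u ∈ X x → multiplicity X u ≡ 1 →
    4 * k * p + 2 * L ≤ sumOver (X x) (λ v → charge 1 (multiplicity X v) (z v)) + 2 * p)
  (single : ∀ u → u ∈ A → multiplicity X u ≡ 0 → 4 * k * p + 2 * L ≤ z u + 2 * p)
  where

  private
    2pk = 2 * (p * k)
    mult = multiplicity X
    s : Fin n → ℕ
    s u = charge 2 (mult u) (z u)
    cost : Fin c → ℕ
    cost x = 2 * (p * bk k (X x))

    2≤pk : 2 ≤ p * k
    2≤pk = *-mono-≤ 1≤p 2≤k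

    2≤2pk : 2 ≤ 2pk
    2≤2pk = ≤-trans 2≤pk (m≤m+n _ _)

    inner? : ∀ x → Dec (∃ λ u → u ∈ X x × mult u ≡ 1)
    inner? x = any? λ u → (u ∈? X x) ×-dec (mult u ≟ℕ 1)

    bonus : Fin c → ℕ
    bonus x = if ⌊ inner? x ⌋ then 2 * L else 0

    cost-exact : ∀ x → 2pk ≤ ∣ X x ∣ → cost x + 4 * k * p ≡ 2pk * ∣ X x ∣ + 2 * p
    cost-exact x big = begin
      2 * (p * bk k (X x)) + 4 * k * p     ≡⟨ ring₁ p k (bk k (X x)) ⟩
      2 * (p * (bk k (X x) + 2 * k))       ≡⟨ cong (λ t → 2 * (p * t)) (bk-exact′ k (X x) (≤-trans (s≤s z≤n) 2≤k) (≤-trans 2≤2pk big)) ⟩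
      2 * (p * (k * ∣ X x ∣ + 1))          ≡⟨ ring₂ p k ∣ X x ∣ ⟩
      2pk * ∣ X x ∣ + 2 * p                ∎
      where
      open ≡-Reasoning
      ring₁ : ∀ p k b → 2 * (p * b) + 4 * k * p ≡ 2 * (p * (b + 2 * k))
      ring₁ = solve-∀
      ring₂ : ∀ p k x → 2 * (p * (k * x + 1)) ≡ 2 * (p * k) * x + 2 * p
      ring₂ = solve-∀

    -- A piece of nonzero size lacks 4kp - 2p for giving 2pk to each vertex. With a private vertex,
    -- `inner` covers this and yields the bonus 2L. Without one, every vertex pays 2, and 2|X| >=
    -- 4pk suffices; here the size threshold is used.
    piece-bound : ∀ x → 2pk * ∣ X x ∣ + bonus x ≤ cost x + sumOver (X x) s
    piece-bound x with inner? x
    ... | no none rewrite +-identityʳ (2pk * ∣ X x ∣) with large x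
    ...   | inj₁ eq rewrite eq | ∣⊥∣≡0 n | *-zeroʳ 2pk = z≤n
    ...   | inj₂ big = begin
        2pk * ∣ X x ∣               ≤⟨ ≤-from (2 * p) (*-monoʳ-≤ 2 big)
                                        (trans (ring₁ (cost x) p k ∣ X x ∣) (trans (cong (_+ 2 * ∣ X x ∣) (cost-exact x big)) (ring₂ (2pk * ∣ X x ∣) (2 * ∣ X x ∣) p))) ⟩
        cost x + 2 * ∣ X x ∣        ≡⟨ cong (cost x +_) (sumOver-const (X x) 2) ⟨
        cost x + sumOver (X x) (λ _ → 2)
          ≤⟨ +-monoʳ-≤ (cost x) (sumOver-mono (X x) λ u h → ≤-reflexive (sym (charge-≢1 2 (z u) λ eq → none (u , ∈ᵇ⇒∈ h , eq)))) ⟩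
        cost x + sumOver (X x) s    ∎
      where
      open ≤-Reasoning
      ring₁ : ∀ co p k x → co + 2 * x + 2 * (2 * (p * k)) ≡ co + 4 * k * p + 2 * x
      ring₁ = solve-∀
      ring₂ : ∀ a b p → a + 2 * p + b ≡ a + b + 2 * p
      ring₂ = solve-∀
    piece-bound x | yes (u , u∈X , one) with large x
    ... | inj₁ eq = contradiction (subst (u ∈_) eq u∈X) ∉⊥
    ... | inj₂ big = begin
        2pk * ∣ X x ∣ + 2 * L   ≤⟨ ≤-from 0 (inner x u u∈X one)
                                    (trans (ring₁ (cost x) S (k) p L) (trans (cong (λ t → t + (S + 2 * L)) (cost-exact x big)) (ring₂ (2pk * ∣ X x ∣) p S L))) ⟩
        cost x + S              ≤⟨ +-monoʳ-≤ (cost x) (sumOver-mono (X x) λ v _ → charge-mono (s≤s z≤n) (mult v) (z v)) ⟩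
        cost x + sumOver (X x) s ∎
      where
      open ≤-Reasoning
      S = sumOver (X x) (λ v → charge 1 (mult v) (z v))
      ring₁ : ∀ co S k p L → co + S + (4 * k * p + 2 * L) ≡ co + 4 * k * p + (S + 2 * L)
      ring₁ = solve-∀
      ring₂ : ∀ a p S L → a + 2 * p + (S + 2 * L) ≡ a + 2 * L + (S + 2 * p) + 0
      ring₂ = solve-∀

    Y = sum λ u → mult u * s u
    T = sum λ u → mult u * 2pk

    pieces-bound : T + sum bonus ≤ sum cost + Y
    pieces-bound = begin
      T + sum bonus                                     ≡⟨ cong (_+ sum bonus) (double-count X (λ _ → 2pk)) ⟨
      sum (λ x → sumOver (X x) (λ _ → 2pk)) + sum bonus ≡⟨ cong (_+ sum bonus) (sum-cong λ x → sumOver-const (X x) 2pk) ⟩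
      sum (λ x → 2pk * ∣ X x ∣) + sum bonus             ≡⟨ sum-+ _ _ ⟨
      sum (λ x → 2pk * ∣ X x ∣ + bonus x)               ≤⟨ sum-mono piece-bound ⟩
      sum (λ x → cost x + sumOver (X x) s)              ≡⟨ sum-+ _ _ ⟩
      sum cost + sum (λ x → sumOver (X x) s)            ≡⟨ cong (sum cost +_) (double-count X s) ⟩
      sum cost + Y                                      ∎
      where open ≤-Reasoning

    mult-outside : ∀ u → u ∈ᵇ A ≡ false → mult u ≡ 0
    mult-outside u u∉A = sum-zero λ x → cong 𝟙 (¬-not λ h → false≢true u∉A (∈ᵇ-⊆ (X⊆A x) h))

    vertices-bound : (f g : Fin n → ℕ) → (∀ u → u ∈ A → f u + mult u * s u ≤ mult u * 2pk + g u) →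
      sumOver A f + Y ≤ T + sumOver A g
    vertices-bound f g h = subst₂ _≤_ (sum-+ _ _) (sum-+ _ _) (sum-mono pt)
      where
      pt : ∀ u → (if u ∈ᵇ A then f u else 0) + mult u * s u ≤ mult u * 2pk + (if u ∈ᵇ A then g u else 0)
      pt u with u ∈ᵇ A in eq
      ... | true = h u (∈ᵇ⇒∈ eq)
      ... | false rewrite mult-outside u eq = z≤n

    -- With multiplicity c + 2 the surplus is (c + 1) 2pk, and pk >= 2 makes this at least 4(c + 1)
    -- = 2(c + 2) + 2c.
    twice : ∀ c → 2pk + suc (suc c) * 2 ≤ suc (suc c) * 2pk
    twice c = ≤-from (2 * c) (*-monoʳ-≤ (2 * (c + 1)) 2≤pk) (ring (p * k) c)
      where
      ring : ∀ q c → (2 + c) * (2 * q) + 2 * (c + 1) * 2 ≡ 2 * q + (2 + c) * 2 + 2 * (c + 1) * q + 2 * c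
      ring = solve-∀

    missed : Fin n → ℕ
    missed u with mult u
    ... | zero = 2 * L
    ... | suc _ = 0

    missed-zero : ∀ u → mult u ≡ 0 → missed u ≡ 2 * L
    missed-zero u eq with mult u | eq
    ... | zero | _ = refl

    -- A vertex is handed 2pk by each of its pieces and owns `z u`; it keeps 2pk and returns `s u`
    -- to each piece. In one piece the account is exact, as `z u` is passed on. In no piece,
    -- connectivity of the single vertex also pays 2L. In several pieces `twice` applies.
    vertex-bound : ∀ u → u ∈ A → 2pk + missed u + mult u * s u ≤ mult u * 2pk + z u
    vertex-bound u u∈A with mult u in eq
    ... | zero = ≤-from (2 * (p * k) ∸ 2 * p) (single u u∈A eq) (ring p k L (z u) (m∸n+n≡m (*-monoʳ-≤ 2 (m≤m*k))))
      where
      m≤m*k : p ≤ p * k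
      m≤m*k = subst (_≤ p * k) (*-identityʳ p) (*-monoʳ-≤ p (≤-trans (s≤s z≤n) 2≤k))
      ring : ∀ p k L z {d} → d + 2 * p ≡ 2 * (p * k) → z + (4 * k * p + 2 * L) ≡ 2 * (p * k) + 2 * L + 0 + (z + 2 * p) + d
      ring p k L z {d} eq = trans (lem₁ p k L z) (trans (cong (λ t → 2 * (p * k) + 2 * L + z + t) (sym eq)) (lem₂ (2 * (p * k)) L z d p))
        where
        lem₁ : ∀ p k L z → z + (4 * k * p + 2 * L) ≡ 2 * (p * k) + 2 * L + z + 2 * (p * k)
        lem₁ = solve-∀
        lem₂ : ∀ a L z d p → a + 2 * L + z + (d + 2 * p) ≡ a + 2 * L + 0 + (z + 2 * p) + d
        lem₂ = solve-∀
    ... | suc zero = ≤-reflexive (ring 2pk (z u))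
      where
      ring : ∀ a z → a + 0 + 1 * z ≡ 1 * a + z
      ring = solve-∀
    ... | suc (suc c) = ≤-trans (≤-reflexive (cong (_+ suc (suc c) * 2) (+-identityʳ 2pk))) (≤-trans (twice c) (m≤m+n _ _))

  -- Shared vertices pay with the constant 2 and never with their degrees, so `z` is absent from the
  -- bound and stays available to pay for `l A` elsewhere.
  doubly-covered : (∀ u → u ∈ A → 2 ≤ multiplicity X u) → 2pk * ∣ A ∣ ≤ sum cost
  doubly-covered h = ≤-from (sum bonus)
    (+-mono-≤ pieces-bound (subst (λ t → sumOver A (λ _ → 2pk) + Y ≤ T + t) (sumOver-zero) (vertices-bound (λ _ → 2pk) (λ _ → 0) pt)))
    (trans (ring (sum cost) T (sum bonus) (sumOver A (λ _ → 2pk)) Y)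
      (cong (λ t → t + (sum cost + Y + (T + 0)) + sum bonus) (sumOver-const A 2pk)))
    where
    sumOver-zero : sumOver A (λ _ → 0) ≡ 0
    sumOver-zero = sumOver-const A 0
    pt : ∀ u → u ∈ A → 2pk + mult u * s u ≤ mult u * 2pk + 0
    pt u u∈A with mult u | h u u∈A
    ... | suc zero | s≤s ()
    ... | suc (suc c) | _ = ≤-trans (twice c) (m≤m+n _ _)
    ring : ∀ co T bo a Y → co + (T + bo + (a + Y)) ≡ a + (co + Y + (T + 0)) + bo
    ring = solve-∀

  -- The vertex `v` is the source of 2L: through `missed` if it lies in no piece, and through the
  -- bonus of its only piece otherwise.
  not-doubly-covered : ∀ v → v ∈ A → multiplicity X v ≤ 1 → 2pk * ∣ A ∣ + 2 * L ≤ sum cost + sumOver A z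
  not-doubly-covered v v∈A v≤1 = ≤-trans (+-monoʳ-≤ (2pk * ∣ A ∣) gain)
    (≤-from 0 (+-mono-≤ pieces-bound (vertices-bound (λ u → 2pk + missed u) z vertex-bound))
      (trans (cong (λ t → sum cost + sumOver A z + (T + sum bonus + (t + Y)))
               (trans (sumOver-distrib-+ A _ _) (cong (_+ sumOver A missed) (sumOver-const A 2pk))))
        (ring (sum cost) (sumOver A z) T (sum bonus) (2pk * ∣ A ∣) (sumOver A missed) Y)))
    where
    ring : ∀ co z T bo a m Y → co + z + (T + bo + (a + m + Y)) ≡ a + (bo + m) + (co + Y + (T + z)) + 0
    ring = solve-∀
    gain : 2 * L ≤ sum bonus + sumOver A missed
    gain with mult v in eq
    ... | zero = ≤-trans (subst (_≤ sumOver A missed) (missed-zero v eq) (sumOver-∈ A missed (∈⇒∈ᵇ v∈A))) (m≤n+m _ _)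
    ... | suc zero with x , v∈X ← 1≤sum⇒∃ (λ x → v ∈ᵇ X x) (≤-reflexive (sym eq)) =
      ≤-trans (subst (_≤ sum bonus) (cong (if_then 2 * L else 0) (⌊⌋-true⁺ (inner? x) (v , ∈ᵇ⇒∈ v∈X , eq))) (≤-sum bonus x)) (m≤m+n _ _)
    ... | suc (suc _) = contradiction v≤1 λ { (s≤s ()) }

-- Edges as elements of Fin (n * n)

opaque
  unfolding sum

  sum-↑ : ∀ a {b} (g : Fin (a + b) → ℕ) → sum g ≡ sum (λ i → g (i ↑ˡ b)) + sum (λ j → g (a ↑ʳ j))
  sum-↑ zero g = refl
  sum-↑ (suc a) g = trans (cong (g zero +_) (sum-↑ a (g ∘ suc))) (sym (+-assoc (g zero) _ _))

  sum-combine : ∀ m (g : Fin (m * n) → ℕ) → sum g ≡ sum (λ i → sum λ j → g (combine {m} {n} i j))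
  sum-combine zero g = refl
  sum-combine {n} (suc m) g = trans (sum-↑ n g) (cong (sum (λ j → g (j ↑ˡ (m * n))) +_) (sum-combine m (g ∘ (n ↑ʳ_))))

src tgt : Fin (n * n) → Fin n
src {n} = quotient n
tgt {n} = remainder {n} n

-- An unordered pair is represented by its ascending ordered pair; all other elements of
-- `Fin (n * n)` are inert, lying in no `edgesOf` and no `insideEdge`.
ascending : Fin (n * n) → Bool
ascending {n} e = ⌊ toℕ (src {n} e) <? toℕ (tgt {n} e) ⌋

insideEdge : Fin (n * n) → Subset n → Bool
insideEdge {n} e A = ascending {n} e ∧ (src {n} e ∈ᵇ A ∧ tgt {n} e ∈ᵇ A)

edgesOf : SimpleGraph n → Fin (n * n) → Bool
edgesOf {n} G e = ascending {n} e ∧ adj G (src {n} e) (tgt {n} e)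

sum-src-tgt : (f : Fin n → Fin n → ℕ) → sum (λ (e : Fin (n * n)) → f (src {n} e) (tgt {n} e)) ≡ sum (λ i → sum (f i))
sum-src-tgt {n} f = trans (sum-combine n _) (sum-cong λ i → sum-cong λ j →
  cong (λ ij → f (proj₁ ij) (proj₂ ij)) (remQuot-combine i j))

countPairs≡cnt : (Q : Fin n → Fin n → Bool) →
  countPairs Q ≡ cnt (λ (e : Fin (n * n)) → ascending {n} e ∧ Q (src {n} e) (tgt {n} e))
countPairs≡cnt {n} Q = trans (sym (sum≡Σᶠ _)) (trans (sum-cong λ i → sym (sum≡Σᶠ _))
  (sym (sum-src-tgt {n} λ i j → 𝟙 (⌊ toℕ i <? toℕ j ⌋ ∧ Q i j))))

insideEdge-ends : ∀ {n} e {A : Subset n} → insideEdge {n} e A ≡ true → src {n} e ∈ A × tgt {n} e ∈ A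
insideEdge-ends {n} e {A} h =
  ∈ᵇ⇒∈ (∧-fst (∧-snd {ascending {n} e} h)) , ∈ᵇ⇒∈ (∧-snd {src {n} e ∈ᵇ A} (∧-snd {ascending {n} e} h))

insideEdge-mono : ∀ {n} e {A B : Subset n} → A ⊆ B → insideEdge {n} e A ≡ true → insideEdge {n} e B ≡ true
insideEdge-mono {n} e {A} A⊆B h = let s , t = insideEdge-ends {n} e {A} h in
  ∧-intro (∧-fst {ascending {n} e} h) (∧-intro (∈⇒∈ᵇ (A⊆B s)) (∈⇒∈ᵇ (A⊆B t)))

insideEdge-∩ : ∀ {n} e (A B : Subset n) → insideEdge {n} e A ≡ true → insideEdge {n} e B ≡ true → insideEdge {n} e (A ∩ B) ≡ true
insideEdge-∩ {n} e A B h h′ = let s , t = insideEdge-ends {n} e {A} h ; s′ , t′ = insideEdge-ends {n} e {B} h′ in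
  ∧-intro (∧-fst {ascending {n} e} h) (∧-intro (∈⇒∈ᵇ (x∈p∩q⁺ (s , s′))) (∈⇒∈ᵇ (x∈p∩q⁺ (t , t′))))

insideEdge-distinct : ∀ {n} e {A : Subset n} → insideEdge {n} e A ≡ true → src {n} e ≢ tgt {n} e
insideEdge-distinct {n} e h eq = <-irrefl (cong toℕ eq) (⌊⌋-true (toℕ (src {n} e) <? toℕ (tgt {n} e)) (∧-fst {ascending {n} e} h))

-- Ordered pairs from `D`: each ascending pair contributes itself and its reversal, and the diagonal
-- contributes the size of `D`.
inside-count : (D : Subset n) → 2 * cnt (λ e → insideEdge {n} e D) + ∣ D ∣ ≤ ∣ D ∣ * ∣ D ∣
inside-count {n} D = begin
  2 * cnt (λ e → insideEdge {n} e D) + ∣ D ∣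
    ≡⟨ cong₂ (λ a b → 2 * a + b) (sum-src-tgt {n} λ i j → lt i j) (card D) ⟩
  2 * sum (λ i → sum (lt i)) + sum 𝟙D
    ≡⟨ cong₂ _+_ (cong (sum (λ i → sum (lt i)) +_) (trans (+-identityʳ _) (sum-swap lt))) (sum-cong λ i → sym (sumOver-⁅⁆ i 𝟙D)) ⟩
  sum (λ i → sum (lt i)) + sum (λ i → sum λ j → lt j i) + sum (λ i → sumOver ⁅ i ⁆ 𝟙D)
    ≡⟨ trans (cong (_+ sum (λ i → sumOver ⁅ i ⁆ 𝟙D)) (sym (sum-+ _ _))) (sym (sum-+ _ _)) ⟩
  sum (λ i → sum (lt i) + sum (λ j → lt j i) + sumOver ⁅ i ⁆ 𝟙D)
    ≤⟨ sum-mono row ⟩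
  sum (λ i → ∣ D ∣ * 𝟙D i)
    ≡⟨ sum-*ˡ ∣ D ∣ 𝟙D ⟨
  ∣ D ∣ * sum 𝟙D
    ≡⟨ cong (∣ D ∣ *_) (card D) ⟨
  ∣ D ∣ * ∣ D ∣ ∎
  where
  open ≤-Reasoning
  𝟙D : Fin n → ℕ
  𝟙D i = 𝟙 (i ∈ᵇ D)
  lt : Fin n → Fin n → ℕ
  lt i j = 𝟙 (⌊ toℕ i <? toℕ j ⌋ ∧ (i ∈ᵇ D ∧ j ∈ᵇ D))
  pt : ∀ i j → lt i j + lt j i + (if j ∈ᵇ ⁅ i ⁆ then 𝟙D j else 0) ≤ 𝟙D i * 𝟙D j
  pt i j with j ∈ᵇ ⁅ i ⁆ in eq
  ... | true with refl ← x∈⁅y⁆⇒x≡y i (∈ᵇ⇒∈ eq) with toℕ i <? toℕ i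
  ...   | yes i<i = contradiction i<i (<-irrefl refl)
  ...   | no _ with i ∈ᵇ D
  ...     | true = ≤-refl
  ...     | false = z≤n
  pt i j | false with i ∈ᵇ D | j ∈ᵇ D | toℕ i <? toℕ j | toℕ j <? toℕ i
  ... | _ | _ | yes i<j | yes j<i = contradiction j<i (<-asym i<j)
  ... | true | true | yes _ | no _ = ≤-refl
  ... | true | true | no _ | yes _ = ≤-refl
  ... | true | true | no _ | no _ = z≤n
  ... | true | false | yes _ | no _ = z≤n
  ... | true | false | no _ | yes _ = z≤n
  ... | true | false | no _ | no _ = z≤n
  ... | false | true | yes _ | no _ = z≤n
  ... | false | true | no _ | yes _ = z≤n
  ... | false | true | no _ | no _ = z≤n
  ... | false | false | yes _ | no _ = z≤n
  ... | false | false | no _ | yes _ = z≤n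
  ... | false | false | no _ | no _ = z≤n
  row : ∀ i → sum (lt i) + sum (λ j → lt j i) + sumOver ⁅ i ⁆ 𝟙D ≤ ∣ D ∣ * 𝟙D i
  row i = begin
    sum (lt i) + sum (λ j → lt j i) + sumOver ⁅ i ⁆ 𝟙D
      ≡⟨ trans (cong (_+ sumOver ⁅ i ⁆ 𝟙D) (sym (sum-+ _ _))) (sym (sum-+ _ _)) ⟩
    sum (λ j → lt i j + lt j i + (if j ∈ᵇ ⁅ i ⁆ then 𝟙D j else 0))
      ≤⟨ sum-mono (pt i) ⟩
    sum (λ j → 𝟙D i * 𝟙D j)
      ≡⟨ sum-*ˡ (𝟙D i) 𝟙D ⟨
    𝟙D i * sum 𝟙D
      ≡⟨ trans (cong (𝟙D i *_) (sym (card D))) (*-comm (𝟙D i) _) ⟩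
    ∣ D ∣ * 𝟙D i ∎

-- A simple graph on fewer than 2pk vertices has at most p (k x − 2k + 1) edges.
square-bound : ∀ p k x → 1 ≤ p → 1 ≤ k → x < 2 * (p * k) → x * x ≤ x + 2 * (p * (k * x ∸ (k + k ∸ 1)))
square-bound p k zero 1≤p 1≤k lt = z≤n
square-bound p k (suc zero) 1≤p 1≤k lt = s≤s z≤n
square-bound p k (suc (suc y)) 1≤p 1≤k lt = subst (λ t → suc (suc y) * suc (suc y) ≤ suc (suc y) + 2 * (p * t)) (sym b≡)
  (≤-from 0 (+-mono-≤ (*-monoʳ-≤ y lt) (*-monoʳ-≤ 2 1≤p)) (ring y p k))
  where
  ring : ∀ y p k → 2 + y + 2 * (p * (k * y + 1)) + (y * (3 + y) + 2 * 1) ≡ (2 + y) * (2 + y) + (y * (2 * (p * k)) + 2 * p) + 0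
  ring = solve-∀
  split : ∀ k y → k * (2 + y) + 1 ≡ k * y + 1 + 2 * k
  split = solve-∀
  shift : ∀ k y q → k * y + 1 + (q + 1) ≡ k * y + 1 + q + 1
  shift = solve-∀
  b≡ : k * suc (suc y) ∸ (k + k ∸ 1) ≡ k * y + 1
  b≡ = trans (cong (_∸ (k + k ∸ 1)) (+-cancelʳ-≡ 1 _ _
         (trans (split k y) (trans (cong (k * y + 1 +_) (sym (k+k∸1+1 1≤k))) (shift k y (k + k ∸ 1))))))
       (m+n∸n≡m (k * y + 1) (k + k ∸ 1))

small-cost : ∀ p k (D : Subset n) → 1 ≤ p → 1 ≤ k → ∣ D ∣ < 2 * (p * k) →
  2 * cnt (λ e → insideEdge {n} e D) ≤ 2 * (p * bk k D)
small-cost p k D 1≤p 1≤k lt = +-cancelʳ-≤ ∣ D ∣ _ _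
  (≤-trans (inside-count D) (≤-trans (square-bound p k ∣ D ∣ 1≤p 1≤k lt) (≤-reflexive (+-comm ∣ D ∣ _))))

∸-superadditive : ∀ a b q → (a ∸ q) + (b ∸ q) ≤ (a + b) ∸ q
∸-superadditive a b q with ≤-total q a
... | inj₁ q≤a = ≤-trans (+-monoʳ-≤ (a ∸ q) (m∸n≤m b q)) (≤-reflexive (sym (+-∸-comm b q≤a)))
... | inj₂ a≤q rewrite m≤n⇒m∸n≡0 a≤q = ∸-monoˡ-≤ q (m≤n+m b a)

opaque
  unfolding sum

  sum-∸ : (f : Fin n → ℕ) (q : ℕ) → sum (λ i → f i ∸ q) ≤ sum f ∸ q
  sum-∸ {zero} f q = z≤n
  sum-∸ {suc n} f q = ≤-trans (+-monoʳ-≤ _ (sum-∸ (f ∘ suc) q)) (∸-superadditive (f zero) _ q)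

-- Cutting a set along the parts is free: sizes add up to at most the old one, and truncated
-- subtraction of a constant is superadditive.
bk-split : ∀ k (A : Subset n) (P : Fin c → Subset n) → (∀ x y → Nonempty (P x ∩ P y) → x ≡ y) →
  sum (λ y → bk k (A ∩ P y)) ≤ bk k A
bk-split k A P separated = ≤-trans (sum-∸ (λ y → k * ∣ A ∩ P y ∣) (k + k ∸ 1))
  (∸-monoˡ-≤ (k + k ∸ 1) (≤-trans (≤-reflexive (sym (sum-*ˡ k _))) (*-monoʳ-≤ k sizes)))
  where
  pt : ∀ u → multiplicity (λ y → A ∩ P y) u * 1 ≤ (if u ∈ᵇ A then 1 else 0)
  pt u with u ∈ᵇ A in eq
  ... | true = ≤-trans (≤-reflexive (*-identityʳ _)) (multiplicity≤1 (λ y → A ∩ P y) u λ x y p q →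
      separated x y (u , x∈p∩q⁺ (p∩q⊆q A _ (∈ᵇ⇒∈ p) , p∩q⊆q A _ (∈ᵇ⇒∈ q))))
  ... | false = ≤-reflexive (trans (*-identityʳ _) (sum-zero λ y → cong 𝟙 (trans (∈ᵇ-∩ u A (P y)) (cong (_∧ _) eq))))
  sizes : sum (λ y → ∣ A ∩ P y ∣) ≤ ∣ A ∣
  sizes = begin
    sum (λ y → ∣ A ∩ P y ∣)                   ≡⟨ sum-cong (λ y → card (A ∩ P y)) ⟩
    sum (λ y → sumOver (A ∩ P y) (λ _ → 1))   ≡⟨ double-count (λ y → A ∩ P y) (λ _ → 1) ⟩
    sum (λ u → multiplicity (λ y → A ∩ P y) u * 1)  ≤⟨ sum-mono pt ⟩
    sumOver A (λ _ → 1)                       ≡⟨ card A ⟨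
    ∣ A ∣                                     ∎
    where open ≤-Reasoning

-- The global counting inequality

sum-if-swap : (B : Fin n → Bool) (f : Fin n → Fin m → ℕ) →
  sum (λ i → if B i then sum (f i) else 0) ≡ sum (λ j → sum λ i → if B i then f i j else 0)
sum-if-swap B f = trans (sum-cong λ i → sym (sum-if (B i) (f i))) (sum-swap _)

𝟙≤if : ∀ {a b s} → (a ≡ true → b ≡ true × 1 ≤ s) → 𝟙 a ≤ (if b then s else 0)
𝟙≤if {false} h = z≤n
𝟙≤if {true} h with refl , 1≤s ← h refl = 1≤s

not-⌊⌋ : ∀ {A : Set} (d : Dec A) → ¬ A → not ⌊ d ⌋ ≡ true
not-⌊⌋ (yes a) ¬a = contradiction a ¬a
not-⌊⌋ (no _) _ = refl

degree : (Fin (n * n) → Bool) → Fin n → ℕ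
degree {n} Z u = sum λ e → if Z e then 𝟙 (u ∈ᵇ ⁅ src {n} e ⁆) + 𝟙 (u ∈ᵇ ⁅ tgt {n} e ⁆) else 0

sumOver-degree : (Z : Fin (n * n) → Bool) (S : Subset n) →
  sumOver S (degree {n} Z) ≡ sum (λ e → if Z e then 𝟙 (src {n} e ∈ᵇ S) + 𝟙 (tgt {n} e ∈ᵇ S) else 0)
sumOver-degree {n} Z S = trans (sum-if-swap (_∈ᵇ S) _) (sum-cong pt)
  where
  ends : ∀ s t → sum (λ u → if u ∈ᵇ S then 𝟙 (u ∈ᵇ ⁅ s ⁆) + 𝟙 (u ∈ᵇ ⁅ t ⁆) else 0) ≡ 𝟙 (s ∈ᵇ S) + 𝟙 (t ∈ᵇ S)
  ends s t = trans (sum-cong swap) (trans (sum-+ _ _) (cong₂ _+_ (sumOver-⁅⁆ s _) (sumOver-⁅⁆ t _)))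
    where
    swap : ∀ u → (if u ∈ᵇ S then 𝟙 (u ∈ᵇ ⁅ s ⁆) + 𝟙 (u ∈ᵇ ⁅ t ⁆) else 0)
      ≡ (if u ∈ᵇ ⁅ s ⁆ then 𝟙 (u ∈ᵇ S) else 0) + (if u ∈ᵇ ⁅ t ⁆ then 𝟙 (u ∈ᵇ S) else 0)
    swap u with u ∈ᵇ S | u ∈ᵇ ⁅ s ⁆ | u ∈ᵇ ⁅ t ⁆
    ... | true | _ | _ = refl
    ... | false | true | true = refl
    ... | false | true | false = refl
    ... | false | false | true = refl
    ... | false | false | false = refl
  pt : ∀ e → sum (λ u → if u ∈ᵇ S then (if Z e then 𝟙 (u ∈ᵇ ⁅ src {n} e ⁆) + 𝟙 (u ∈ᵇ ⁅ tgt {n} e ⁆) else 0) else 0)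
    ≡ (if Z e then 𝟙 (src {n} e ∈ᵇ S) + 𝟙 (tgt {n} e ∈ᵇ S) else 0)
  pt e with Z e
  ... | true = ends (src {n} e) (tgt {n} e)
  ... | false = sum-zero λ u → Bool.if-eta (u ∈ᵇ S)

sum-degree : (Z : Fin (n * n) → Bool) → sum (degree {n} Z) ≡ 2 * cnt Z
sum-degree {n} Z = begin
  sum (degree {n} Z)                        ≡⟨ sumOver-⊤ (degree {n} Z) ⟨
  sumOver ⊤ (degree {n} Z)                  ≡⟨ sumOver-degree {n} Z ⊤ ⟩
  sum (λ e → if Z e then 𝟙 (src {n} e ∈ᵇ ⊤) + 𝟙 (tgt {n} e ∈ᵇ ⊤) else 0)  ≡⟨ sum-cong pt ⟩
  sum (λ e → 2 * 𝟙 (Z e))               ≡⟨ sum-*ˡ 2 _ ⟨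
  2 * cnt Z                             ∎
  where
  open ≡-Reasoning
  pt : ∀ e → (if Z e then 𝟙 (src {n} e ∈ᵇ ⊤) + 𝟙 (tgt {n} e ∈ᵇ ⊤) else 0) ≡ 2 * 𝟙 (Z e)
  pt e rewrite ∈ᵇ-⊤ (src {n} e) | ∈ᵇ-⊤ (tgt {n} e) with Z e
  ... | true = refl
  ... | false = refl

_≟ˢ_ : (A B : Subset n) → Dec (A ≡ B)
_≟ˢ_ = ≡-dec Bool._≟_

Empty⇒≡⊥ : {A : Subset n} → (∀ u → u ∉ A) → A ≡ ⊥
Empty⇒≡⊥ h = ⊆-antisym (λ u∈A → contradiction u∈A (h _)) λ u∈⊥ → contradiction u∈⊥ ∉⊥

-- `loss e` is how often `e` is counted individually, and `kept` says that every other edge lies in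
-- a member of both families. The hypotheses `⁅⁆≢⊤` and `proper` keep the sets given to the
-- connectivity hypothesis away from the whole vertex set.
module Count {n c d : ℕ} (G : SimpleGraph n) (l : SetFun n) (p k : ℕ)
  (l-⊥ : l ⊥ ≡ 0) (l-noninc : Nonincreasing l) (1≤p : 1 ≤ p) (2≤k : 2 ≤ k) (conn : Connected4kp k p l G)
  (C : Fin c → Subset n) (P : Fin d → Subset n)
  (separated : ∀ x y → Nonempty (P x ∩ P y) → x ≡ y)
  (covers : ∀ v → ∃ λ y → v ∈ P y)
  (⁅⁆≢⊤ : ∀ (u : Fin n) → ⁅ u ⁆ ≢ ⊤)
  (proper : ∀ x y → C x ∩ P y ≢ ⊤)
  (loss : Fin (n * n) → ℕ)
  (kept : ∀ e → edgesOf G e ≡ true → 1 ≤ loss e ⊎ ∃₂ λ x y → insideEdge {n} e (C x ∩ P y) ≡ true)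
  where

  private
    1≤k : 1 ≤ k
    1≤k = ≤-trans (s≤s z≤n) 2≤k

    2pk = 2 * (p * k)

    big? : ∀ y x → Dec (2pk ≤ ∣ C x ∩ P y ∣)
    big? y x = 2pk ≤? ∣ C x ∩ P y ∣

    -- A small piece becomes `⊥` instead of being removed, so that the pieces remain indexed by all
    -- pairs; `⊥` costs nothing and contains no edge.
    D : Fin d → Fin c → Subset n
    D y x = if ⌊ big? y x ⌋ then C x ∩ P y else ⊥

    D⊆ : ∀ y x → D y x ⊆ C x ∩ P y
    D⊆ y x u∈D with big? y x
    ... | yes _ = u∈D
    ... | no _ = contradiction u∈D ∉⊥

    D⊆P : ∀ y x → D y x ⊆ P y
    D⊆P y x u∈D = p∩q⊆q (C x) (P y) (D⊆ y x u∈D)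

    D-large : ∀ y x → D y x ≡ ⊥ ⊎ 2pk ≤ ∣ D y x ∣
    D-large y x with big? y x
    ... | yes big = inj₂ big
    ... | no _ = inj₁ refl

    insideD? : ∀ e → Dec (∃ λ y → ∃ λ x → insideEdge {n} e (D y x) ≡ true)
    insideD? e = any? λ y → any? λ x → insideEdge {n} e (D y x) Bool.≟ true

    Z : Fin (n * n) → Bool
    Z e = edgesOf G e ∧ not ⌊ insideD? e ⌋

    z : Fin n → ℕ
    z = degree {n} Z

    same-part : ∀ {u y y′} → u ∈ P y → u ∈ P y′ → y ≡ y′
    same-part {u} h h′ = separated _ _ (u , x∈p∩q⁺ (h , h′))

    -- By `closed`, a piece that meets `S` stays in the union of `S` and `B`. An edge counted on the
    -- left thus lies in no piece and contributes to `z` at its end in `S`.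
    cut : ∀ S B → (∀ {u v y x} → u ∈ S → u ∈ D y x → v ∈ D y x → v ∈ S ⊎ v ∈ B) → dMinus G B S ≤ sumOver S z
    cut S B closed = begin
      dMinus G B S                                    ≡⟨ countPairs≡cnt {n} (λ i j → adj G i j ∧ crossing i j) ⟩
      cnt (λ e → ascending {n} e ∧ (adj G (src {n} e) (tgt {n} e) ∧ crossing (src {n} e) (tgt {n} e)))  ≤⟨ sum-mono pt ⟩
      sum (λ e → if Z e then 𝟙 (src {n} e ∈ᵇ S) + 𝟙 (tgt {n} e ∈ᵇ S) else 0)  ≡⟨ sumOver-degree {n} Z S ⟨
      sumOver S z                                     ∎
      where
      open ≤-Reasoning
      out : Fin n → Bool
      out v = not (v ∈ᵇ S) ∧ not (v ∈ᵇ B)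
      crossing : Fin n → Fin n → Bool
      crossing i j = (i ∈ᵇ S ∧ out j) ∨ (out i ∧ j ∈ᵇ S)
      escape : ∀ {u v y x} → u ∈ᵇ S ≡ true → out v ≡ true → u ∈ D y x → v ∉ D y x
      escape {u} {v} u∈S v-out u∈D v∈D with closed (∈ᵇ⇒∈ u∈S) u∈D v∈D
      ... | inj₁ v∈S rewrite ∈⇒∈ᵇ v∈S with () ← v-out
      ... | inj₂ v∈B rewrite ∈⇒∈ᵇ v∈B with () ← trans (sym (Bool.∧-zeroʳ (not (v ∈ᵇ S)))) v-out
      crossing-cases : ∀ i j → crossing i j ≡ true → (i ∈ᵇ S ≡ true × out j ≡ true) ⊎ (j ∈ᵇ S ≡ true × out i ≡ true)
      crossing-cases i j h with i ∈ᵇ S ∧ out j in eq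
      ... | true = inj₁ (∧-fst eq , ∧-snd {i ∈ᵇ S} eq)
      ... | false = inj₂ (∧-snd {out i} h , ∧-fst h)
      one : ∀ i j → crossing i j ≡ true → 1 ≤ 𝟙 (i ∈ᵇ S) + 𝟙 (j ∈ᵇ S)
      one i j h with crossing-cases i j h
      ... | inj₁ (i∈S , _) rewrite i∈S = s≤s z≤n
      ... | inj₂ (j∈S , _) rewrite j∈S = m≤n+m 1 _
      pt : ∀ e → 𝟙 (ascending {n} e ∧ (adj G (src {n} e) (tgt {n} e) ∧ crossing (src {n} e) (tgt {n} e)))
        ≤ (if Z e then 𝟙 (src {n} e ∈ᵇ S) + 𝟙 (tgt {n} e ∈ᵇ S) else 0)
      pt e = 𝟙≤if λ h →
        let cr = ∧-snd {adj G (src {n} e) (tgt {n} e)} (∧-snd {ascending {n} e} h)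
        in ∧-intro (∧-intro (∧-fst {ascending {n} e} h) (∧-fst (∧-snd {ascending {n} e} h))) (not-⌊⌋ (insideD? e) (avoids e cr))
          , one (src {n} e) (tgt {n} e) cr
        where
        avoids : ∀ e → crossing (src {n} e) (tgt {n} e) ≡ true → ¬ ∃ λ y → ∃ λ x → insideEdge {n} e (D y x) ≡ true
        avoids e cr (y , x , ins) with insideEdge-ends {n} e {D y x} ins | crossing-cases (src {n} e) (tgt {n} e) cr
        ... | s∈D , t∈D | inj₁ (s∈S , t-out) = escape s∈S t-out s∈D t∈D
        ... | s∈D , t∈D | inj₂ (t∈S , s-out) = escape t∈S s-out t∈D s∈D

    -- Connectivity with `B` empty, where monotonicity of `l` replaces the value on `S` by the
    -- possibly smaller value on its part.
    cut-alone : ∀ y S → Nonempty S → S ⊆ P y → S ≢ ⊤ → (∀ {u v y x} → u ∈ S → u ∈ D y x → v ∈ D y x → v ∈ S) →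
      4 * k * p + 2 * l (P y) ≤ sumOver S z + 2 * p
    cut-alone y S (u , u∈S) S⊆P S≢⊤ closed = begin
      4 * k * p + 2 * l (P y)           ≤⟨ +-monoʳ-≤ (4 * k * p) (*-monoʳ-≤ 2 (l-noninc (S ∪ ⊥) (P y) (u , p⊆p∪q ⊥ u∈S) (S⊆P ∘ back))) ⟩
      4 * k * p + 2 * l (S ∪ ⊥)         ≤⟨ conn S ⊥ (u , u∈S) (λ { (_ , v∈) → ∉⊥ (p∩q⊆q S ⊥ v∈) }) (λ eq → S≢⊤ (trans (sym (∪-identityʳ S)) eq)) ⟩
      dMinus G ⊥ S + ∣ ⊥ {n} ∣ + 2 * p  ≡⟨ cong (λ t → dMinus G ⊥ S + t + 2 * p) (∣⊥∣≡0 n) ⟩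
      dMinus G ⊥ S + 0 + 2 * p          ≡⟨ cong (_+ 2 * p) (+-identityʳ (dMinus G ⊥ S)) ⟩
      dMinus G ⊥ S + 2 * p              ≤⟨ +-monoˡ-≤ (2 * p) (cut S ⊥ λ a b c → inj₁ (closed a b c)) ⟩
      sumOver S z + 2 * p               ∎
      where
      open ≤-Reasoning
      back : S ∪ ⊥ ⊆ S
      back v∈ = subst (_ ∈_) (∪-identityʳ S) v∈

    module Part (y : Fin d) where
      mult = multiplicity (D y)

      -- Connectivity with `S` the private and `B` the shared vertices of the piece. A private
      -- vertex lies in no other piece of its part and in no piece of another part, which gives
      -- `closed`. The shared vertices enter as the size of `B`, one unit each, as in `charge 1`.
      inner : ∀ x u → u ∈ D y x → mult u ≡ 1 →
        4 * k * p + 2 * l (P y) ≤ sumOver (D y x) (λ v → charge 1 (mult v) (z v)) + 2 * p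
      inner x u u∈X one = begin
        4 * k * p + 2 * l (P y)              ≤⟨ +-monoʳ-≤ (4 * k * p) (*-monoʳ-≤ 2 (l-noninc (S ∪ B) (P y) (u , p⊆p∪q B u∈S) (D⊆P y x ∘ SB⊆X))) ⟩
        4 * k * p + 2 * l (S ∪ B)            ≤⟨ conn S B (u , u∈S) disjoint (λ eq → proper x y (⊆-antisym ⊆⊤ (λ v∈ → D⊆ y x (SB⊆X (subst (_ ∈_) (sym eq) v∈))))) ⟩
        dMinus G B S + ∣ B ∣ + 2 * p         ≤⟨ +-monoˡ-≤ (2 * p) (+-mono-≤ (cut S B closed) (≤-reflexive (card B))) ⟩
        sumOver S z + sumOver B (λ _ → 1) + 2 * p  ≤⟨ +-monoˡ-≤ (2 * p) (≤-trans (≤-reflexive (sym (sum-+ _ _))) (sum-mono pt)) ⟩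
        sumOver (D y x) (λ v → charge 1 (mult v) (z v)) + 2 * p ∎
        where
        open ≤-Reasoning
        once : Fin n → Bool
        once v = ⌊ mult v ≟ℕ 1 ⌋
        S B : Subset n
        S = tabulate λ v → v ∈ᵇ D y x ∧ once v
        B = tabulate λ v → v ∈ᵇ D y x ∧ not (once v)
        S⇒ : ∀ {v} → v ∈ S → v ∈ᵇ D y x ∧ once v ≡ true
        S⇒ {v} v∈S = trans (sym (lookup∘tabulate _ v)) (∈⇒∈ᵇ v∈S)
        ⇒S : ∀ {v} → v ∈ᵇ D y x ∧ once v ≡ true → v ∈ S
        ⇒S {v} h = ∈ᵇ⇒∈ (trans (lookup∘tabulate _ v) h)
        B⇒ : ∀ {v} → v ∈ B → v ∈ᵇ D y x ∧ not (once v) ≡ true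
        B⇒ {v} v∈B = trans (sym (lookup∘tabulate _ v)) (∈⇒∈ᵇ v∈B)
        ⇒B : ∀ {v} → v ∈ᵇ D y x ∧ not (once v) ≡ true → v ∈ B
        ⇒B {v} h = ∈ᵇ⇒∈ (trans (lookup∘tabulate _ v) h)
        u∈S : u ∈ S
        u∈S = ⇒S (∧-intro (∈⇒∈ᵇ u∈X) (⌊⌋-true⁺ (mult u ≟ℕ 1) one))
        SB⊆X : S ∪ B ⊆ D y x
        SB⊆X v∈ with x∈p∪q⁻ S B v∈
        ... | inj₁ v∈S = ∈ᵇ⇒∈ (∧-fst (S⇒ v∈S))
        ... | inj₂ v∈B = ∈ᵇ⇒∈ (∧-fst (B⇒ v∈B))
        disjoint : Empty (S ∩ B)
        disjoint (v , v∈) with x∈p∩q⁻ S B v∈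
        ... | v∈S , v∈B with once v | ∧-snd {v ∈ᵇ D y x} (S⇒ v∈S) | ∧-snd {v ∈ᵇ D y x} (B⇒ v∈B)
        ...   | true | _ | ()
        ...   | false | () | _
        closed : ∀ {v w y′ x′} → v ∈ S → v ∈ D y′ x′ → w ∈ D y′ x′ → w ∈ S ⊎ w ∈ B
        closed {v} {w} {y′} {x′} v∈S v∈D w∈D
          with refl ← same-part (D⊆P y x (∈ᵇ⇒∈ (∧-fst (S⇒ v∈S)))) (D⊆P y′ x′ v∈D)
          with refl ← sum-𝟙≤1⇒unique (λ t → v ∈ᵇ D y t)
                 (≤-reflexive (⌊⌋-true (mult v ≟ℕ 1) (∧-snd {v ∈ᵇ D y x} (S⇒ v∈S))))
                 x x′ (∧-fst (S⇒ v∈S)) (∈⇒∈ᵇ v∈D)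
          with once w in eq
        ... | true = inj₁ (⇒S (∧-intro (∈⇒∈ᵇ w∈D) eq))
        ... | false = inj₂ (⇒B (∧-intro (∈⇒∈ᵇ w∈D) (cong not eq)))
        pt : ∀ v → (if v ∈ᵇ S then z v else 0) + (if v ∈ᵇ B then 1 else 0) ≤ (if v ∈ᵇ D y x then charge 1 (mult v) (z v) else 0)
        pt v rewrite lookup∘tabulate (λ v → v ∈ᵇ D y x ∧ once v) v | lookup∘tabulate (λ v → v ∈ᵇ D y x ∧ not (once v)) v
          with v ∈ᵇ D y x
        ... | false = z≤n
        ... | true with mult v ≟ℕ 1
        ...   | yes eq rewrite eq = ≤-reflexive (+-identityʳ _)
        ...   | no neq rewrite charge-≢1 1 (z v) neq = ≤-refl

      single : ∀ u → u ∈ P y → mult u ≡ 0 → 4 * k * p + 2 * l (P y) ≤ z u + 2 * p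
      single u u∈P none = subst (λ t → 4 * k * p + 2 * l (P y) ≤ t + 2 * p) (sumOver-⁅⁆ u z)
        (cut-alone y ⁅ u ⁆ (u , x∈⁅x⁆ u) (λ v∈ → subst (_∈ P y) (sym (x∈⁅y⁆⇒x≡y u v∈)) u∈P) (⁅⁆≢⊤ u) closed)
        where
        closed : ∀ {v w y′ x′} → v ∈ ⁅ u ⁆ → v ∈ D y′ x′ → w ∈ D y′ x′ → w ∈ ⁅ u ⁆
        closed {y′ = y′} {x′} v∈ v∈D w∈D
          with refl ← x∈⁅y⁆⇒x≡y u v∈
          with refl ← same-part u∈P (D⊆P y′ x′ v∈D) =
          contradiction (subst (1 ≤_) none (1≤multiplicity (D y) u x′ (∈⇒∈ᵇ v∈D))) λ ()

      -- Pieces stay within their parts, so all edges leaving a part count in `z`; the constant 4kp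
      -- - 2p of the connectivity bound is given away as slack.
      whole : Nonempty (P y) → P y ≢ ⊤ → 2 * l (P y) ≤ sumOver (P y) z
      whole ne P≢⊤ = ≤-from (4 * k * p ∸ 2 * p) (cut-alone y (P y) ne ⊆-refl P≢⊤ closed)
        (trans (cong (λ t → sumOver (P y) z + (t + 2 * l (P y))) (sym (m∸n+n≡m 2p≤4kp))) (ring (sumOver (P y) z) _ p (l (P y))))
        where
        2p≤4kp : 2 * p ≤ 4 * k * p
        2p≤4kp = *-monoˡ-≤ p (*-mono-≤ {2} {4} (s≤s (s≤s z≤n)) 1≤k)
        ring : ∀ s d p l → s + (d + 2 * p + 2 * l) ≡ 2 * l + (s + 2 * p) + d
        ring = solve-∀
        closed : ∀ {v w y′ x′} → v ∈ P y → v ∈ D y′ x′ → w ∈ D y′ x′ → w ∈ P y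
        closed {y′ = y′} {x′} v∈ v∈D w∈D with refl ← same-part v∈ (D⊆P y′ x′ v∈D) = D⊆P y′ x′ w∈D

      open Local p k 1≤p 2≤k (P y) (D y) z (l (P y)) (D⊆P y) (D-large y) inner single public

    -- A part equal to the whole vertex set cannot be cut off from anything, so it demands nothing
    -- here; the term `l ⊤` of the rank inequality accounts for it through `partition-demand`.
    demand : Fin d → ℕ
    demand y = if ⌊ P y ≟ˢ ⊤ ⌋ then 0 else l (P y)

    demand≤ : ∀ y → demand y ≤ l (P y)
    demand≤ y with P y ≟ˢ ⊤
    ... | yes _ = z≤n
    ... | no _ = ≤-refl

    costs : Fin d → ℕ
    costs y = sum λ x → 2 * (p * bk k (D y x))

    part-bound : ∀ y → 2pk * ∣ P y ∣ + 2 * demand y ≤ costs y + sumOver (P y) z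
    part-bound y with any? (λ v → (v ∈? P y) ×-dec (multiplicity (D y) v ≤? 1))
    ... | yes (v , v∈P , v≤1) = ≤-trans (+-monoʳ-≤ (2pk * ∣ P y ∣) (*-monoʳ-≤ 2 (demand≤ y)))
            (Part.not-doubly-covered y v v∈P v≤1)
    ... | no none = +-mono-≤ (Part.doubly-covered y λ u u∈P → ≰⇒> λ u≤1 → none (u , u∈P , u≤1)) bound
      where
      bound : 2 * demand y ≤ sumOver (P y) z
      bound with P y ≟ˢ ⊤
      ... | yes _ = z≤n
      ... | no P≢⊤ with nonempty? (P y)
      ...   | yes ne = Part.whole y ne P≢⊤
      ...   | no empty rewrite trans (cong l (Empty⇒≡⊥ λ u u∈ → empty (u , u∈))) l-⊥ = z≤n

    small : Fin d → Fin c → ℕ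
    small y x = if ⌊ big? y x ⌋ then 0 else 2 * cnt (λ e → insideEdge {n} e (C x ∩ P y))

    -- Dropping a small piece frees its cost, and `small-cost` shows that this pays two units for
    -- each pair of vertices inside it.
    small-bound : ∀ y x → 2 * (p * bk k (D y x)) + small y x ≤ 2 * (p * bk k (C x ∩ P y))
    small-bound y x with big? y x
    ... | yes _ = ≤-reflexive (+-identityʳ _)
    ... | no ¬big rewrite bk-⊥ {n} k | *-zeroʳ p = small-cost p k (C x ∩ P y) 1≤p 1≤k (≰⇒> ¬big)

    -- An edge of `G` outside all pieces is either counted individually in `loss` or lay inside a
    -- piece dropped for being small.
    Z-bound : 2 * cnt Z ≤ 2 * sum loss + sum (λ y → sum (small y))
    Z-bound = begin
      2 * cnt Z
        ≡⟨ sum-*ˡ 2 _ ⟩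
      sum (λ e → 2 * 𝟙 (Z e))
        ≤⟨ sum-mono pt ⟩
      sum (λ e → 2 * loss e + sum (λ y → sum λ x → small₁ y x e))
        ≡⟨ sum-+ _ _ ⟩
      sum (λ e → 2 * loss e) + sum (λ e → sum λ y → sum λ x → small₁ y x e)
        ≡⟨ cong₂ _+_ (sym (sum-*ˡ 2 loss)) (trans (sum-swap _) (sum-cong λ y → trans (sum-swap _) (sum-cong λ x → collect y x))) ⟩
      2 * sum loss + sum (λ y → sum (small y)) ∎
      where
      open ≤-Reasoning
      small₁ : Fin d → Fin c → Fin (n * n) → ℕ
      small₁ y x e = if ⌊ big? y x ⌋ then 0 else 2 * 𝟙 (insideEdge {n} e (C x ∩ P y))
      collect : ∀ y x → sum (small₁ y x) ≡ small y x
      collect y x with big? y x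
      ... | yes _ = sum-zero λ _ → refl
      ... | no _ = sym (sum-*ˡ 2 _)
      small-hit : ∀ y x e → insideEdge {n} e (C x ∩ P y) ≡ true → ¬ insideEdge {n} e (D y x) ≡ true → 2 ≤ small₁ y x e
      small-hit y x e ins nins with big? y x
      ... | yes _ = contradiction ins nins
      ... | no _ rewrite ins = ≤-refl
      pt : ∀ e → 2 * 𝟙 (Z e) ≤ 2 * loss e + sum (λ y → sum λ x → small₁ y x e)
      pt e with edgesOf G e in eq
      ... | false = z≤n
      ... | true with insideD? e
      ...   | yes _ = z≤n
      ...   | no out with kept e eq
      ...     | inj₁ 1≤ = ≤-trans (*-monoʳ-≤ 2 1≤) (m≤m+n _ _)
      ...     | inj₂ (x , y , ins) = ≤-trans (small-hit y x e ins (λ h → out (y , x , h)))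
                  (≤-trans (≤-sum (λ x → small₁ y x e) x) (≤-trans (≤-sum (λ y → sum λ x → small₁ y x e) y) (m≤n+m _ _)))

    refine-bound : sum costs + sum (λ y → sum (small y)) ≤ 2 * (p * sum (bk k ∘ C))
    refine-bound = begin
      sum costs + sum (λ y → sum (small y))
        ≡⟨ sum-+ _ _ ⟨
      sum (λ y → costs y + sum (small y))
        ≤⟨ sum-mono (λ y → ≤-trans (≤-reflexive (sym (sum-+ _ _))) (sum-mono (small-bound y))) ⟩
      sum (λ y → sum λ x → 2 * (p * bk k (C x ∩ P y)))
        ≡⟨ trans (sum-swap _) (sum-cong λ x → trans (sym (sum-*ˡ 2 _)) (cong (2 *_) (sym (sum-*ˡ p _)))) ⟩
      sum (λ x → 2 * (p * sum (λ y → bk k (C x ∩ P y))))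
        ≤⟨ sum-mono (λ x → *-monoʳ-≤ 2 (*-monoʳ-≤ p (bk-split k (C x) P separated))) ⟩
      sum (λ x → 2 * (p * bk k (C x)))
        ≡⟨ trans (sym (sum-*ˡ 2 _)) (cong (2 *_) (sym (sum-*ˡ p _))) ⟩
      2 * (p * sum (bk k ∘ C)) ∎
      where open ≤-Reasoning

    vertices : n ≤ sum (λ y → ∣ P y ∣)
    vertices = begin
      n                                       ≡⟨ trans (sum-const n 1) (*-identityʳ n) ⟨
      sum {n} (λ _ → 1)                       ≤⟨ sum-mono (λ u → let y , u∈P = covers u in 1≤multiplicity P u y (∈⇒∈ᵇ u∈P)) ⟩
      sum (λ u → multiplicity P u)            ≡⟨ sum-cong (λ u → sym (*-identityʳ _)) ⟩
      sum (λ u → multiplicity P u * 1)        ≡⟨ double-count P (λ _ → 1) ⟨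
      sum (λ y → sumOver (P y) (λ _ → 1))     ≡⟨ sum-cong (λ y → sym (card (P y))) ⟩
      sum (λ y → ∣ P y ∣)                     ∎
      where open ≤-Reasoning

    degrees : sum (λ y → sumOver (P y) z) ≤ 2 * cnt Z
    degrees = begin
      sum (λ y → sumOver (P y) z)       ≡⟨ double-count P z ⟩
      sum (λ u → multiplicity P u * z u) ≤⟨ sum-mono (λ u → ≤-trans (*-monoˡ-≤ (z u) (multiplicity≤1 P u λ x y h h′ → same-part (∈ᵇ⇒∈ h) (∈ᵇ⇒∈ h′))) (≤-reflexive (*-identityˡ (z u)))) ⟩
      sum z                             ≡⟨ sum-degree {n} Z ⟩
      2 * cnt Z                         ∎
      where open ≤-Reasoning

  count : 2 * (p * k * n + sum (λ y → if ⌊ P y ≟ˢ ⊤ ⌋ then 0 else l (P y))) ≤ 2 * (p * sum (bk k ∘ C) + sum loss)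
  count = begin
    2 * (p * k * n + sum demand)                              ≡⟨ ring₁ (p * k) n (sum demand) ⟩
    2pk * n + 2 * sum demand                                  ≤⟨ +-monoˡ-≤ _ (*-monoʳ-≤ 2pk vertices) ⟩
    2pk * sum (λ y → ∣ P y ∣) + 2 * sum demand                ≡⟨ trans (cong₂ _+_ (sum-*ˡ 2pk _) (sum-*ˡ 2 demand)) (sym (sum-+ _ _)) ⟩
    sum (λ y → 2pk * ∣ P y ∣ + 2 * demand y)                  ≤⟨ sum-mono part-bound ⟩
    sum (λ y → costs y + sumOver (P y) z)                     ≡⟨ sum-+ _ _ ⟩
    sum costs + sum (λ y → sumOver (P y) z)                   ≤⟨ +-monoʳ-≤ (sum costs) (≤-trans degrees Z-bound) ⟩
    sum costs + (2 * sum loss + sum (λ y → sum (small y)))    ≡⟨ ring₂ (sum costs) (sum loss) _ ⟩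
    sum costs + sum (λ y → sum (small y)) + 2 * sum loss      ≤⟨ +-monoˡ-≤ _ refine-bound ⟩
    2 * (p * sum (bk k ∘ C)) + 2 * sum loss                   ≡⟨ *-distribˡ-+ 2 (p * sum (bk k ∘ C)) _ ⟨
    2 * (p * sum (bk k ∘ C) + sum loss)                       ∎
    where
    open ≤-Reasoning
    ring₁ : ∀ q n d → 2 * (q * n + d) ≡ 2 * q * n + 2 * d
    ring₁ = solve-∀
    ring₂ : ∀ a b c → a + (2 * b + c) ≡ a + c + 2 * b
    ring₂ = solve-∀

-- The two sparsity matroids

distinct⇒2≤ : {A : Subset n} {u v : Fin n} → u ≢ v → u ∈ A → v ∈ A → 2 ≤ ∣ A ∣
distinct⇒2≤ {n} {A} {u} {v} u≢v u∈A v∈A = begin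
  2                                              ≡⟨ cong₂ _+_ (sumOver-⁅⁆ u (λ _ → 1)) (sumOver-⁅⁆ v (λ _ → 1)) ⟨
  sumOver ⁅ u ⁆ (λ _ → 1) + sumOver ⁅ v ⁆ (λ _ → 1)  ≡⟨ sum-+ _ _ ⟨
  sum (λ w → 𝟙 (w ∈ᵇ ⁅ u ⁆) + 𝟙 (w ∈ᵇ ⁅ v ⁆))        ≤⟨ sum-mono pt ⟩
  sumOver A (λ _ → 1)                            ≡⟨ card A ⟨
  ∣ A ∣                                          ∎
  where
  open ≤-Reasoning
  pt : ∀ w → 𝟙 (w ∈ᵇ ⁅ u ⁆) + 𝟙 (w ∈ᵇ ⁅ v ⁆) ≤ 𝟙 (w ∈ᵇ A)
  pt w with w ∈ᵇ ⁅ u ⁆ in p | w ∈ᵇ ⁅ v ⁆ in q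
  ... | true | true = contradiction (trans (sym (x∈⁅y⁆⇒x≡y u (∈ᵇ⇒∈ p))) (x∈⁅y⁆⇒x≡y v (∈ᵇ⇒∈ q))) u≢v
  ... | true | false rewrite x∈⁅y⁆⇒x≡y u (∈ᵇ⇒∈ p) | ∈⇒∈ᵇ u∈A = ≤-refl
  ... | false | true rewrite x∈⁅y⁆⇒x≡y v (∈ᵇ⇒∈ q) | ∈⇒∈ᵇ v∈A = ≤-refl
  ... | false | false = z≤n

k≤k+k∸1 : ∀ {k} → 1 ≤ k → k ≤ k + k ∸ 1
k≤k+k∸1 {suc k} _ = m≤n+m (suc k) k

bk-⁅⁆ : ∀ k → 1 ≤ k → (v : Fin n) → bk k ⁅ v ⁆ ≡ 0
bk-⁅⁆ k 1≤k v rewrite ∣⁅x⁆∣≡1 v | *-identityʳ k = m≤n⇒m∸n≡0 (k≤k+k∸1 1≤k)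

-- With two common vertices no term is truncated and the claim reduces to modularity of cardinality.
-- With exactly one common vertex it fails by k - 1 for larger sets, which is why `Touch` asks for
-- two.
bk-submod : ∀ k → 1 ≤ k → (A B : Subset n) → 2 ≤ ∣ A ∩ B ∣ → bk k (A ∩ B) + bk k (A ∪ B) ≤ bk k A + bk k B
bk-submod k 1≤k A B 2≤ = ≤-reflexive (+-cancelʳ-≡ (q + q) _ _ (begin
  bk k (A ∩ B) + bk k (A ∪ B) + (q + q)      ≡⟨ interchange (bk k (A ∩ B)) _ q ⟩
  (bk k (A ∩ B) + q) + (bk k (A ∪ B) + q)    ≡⟨ cong₂ _+_ (bk-exact k (A ∩ B) 1≤k 2≤) (bk-exact k (A ∪ B) 1≤k (grow (p⊆p∪q B ∘ p∩q⊆p A B))) ⟩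
  k * ∣ A ∩ B ∣ + k * ∣ A ∪ B ∣              ≡⟨ *-distribˡ-+ k ∣ A ∩ B ∣ _ ⟨
  k * (∣ A ∩ B ∣ + ∣ A ∪ B ∣)                ≡⟨ cong (k *_) (card-modular A B) ⟩
  k * (∣ A ∣ + ∣ B ∣)                        ≡⟨ *-distribˡ-+ k ∣ A ∣ _ ⟩
  k * ∣ A ∣ + k * ∣ B ∣                      ≡⟨ cong₂ _+_ (bk-exact k A 1≤k (grow (p∩q⊆p A B))) (bk-exact k B 1≤k (grow (p∩q⊆q A B))) ⟨
  (bk k A + q) + (bk k B + q)                ≡⟨ interchange (bk k A) _ q ⟨
  bk k A + bk k B + (q + q)                  ∎))
  where
  open ≡-Reasoning
  q = k + k ∸ 1
  grow : ∀ {D} → A ∩ B ⊆ D → 2 ≤ ∣ D ∣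
  grow s = ≤-trans 2≤ (p⊆q⇒∣p∣≤∣q∣ s)
  interchange : ∀ a b q → a + b + (q + q) ≡ (a + q) + (b + q)
  interchange = solve-∀

insideEdge⇒2≤ : ∀ {n} e (A B : Subset n) → insideEdge {n} e A ≡ true → insideEdge {n} e B ≡ true → 2 ≤ ∣ A ∩ B ∣
insideEdge⇒2≤ {n} e A B h h′ = let s , t = insideEdge-ends {n} e {A ∩ B} (insideEdge-∩ {n} e A B h h′) in
  distinct⇒2≤ (insideEdge-distinct {n} e {A} h) s t

insideEdge⇒Nonempty : ∀ {n} e (A B : Subset n) → insideEdge {n} e A ≡ true → insideEdge {n} e B ≡ true → Nonempty (A ∩ B)
insideEdge⇒Nonempty {n} e A B h h′ = src {n} e , proj₁ (insideEdge-ends {n} e {A ∩ B} (insideEdge-∩ {n} e A B h h′))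

module KSparse (n k : ℕ) (1≤k : 1 ≤ k) where

  open Sparsity {n * n} {n} (insideEdge {n}) (bk k)
    (λ A B → 2 ≤ ∣ A ∩ B ∣) (λ A B → 2 ≤? ∣ A ∩ B ∣)
    (insideEdge-mono {n}) (insideEdge-∩ {n}) (insideEdge⇒2≤ {n})
    (bk-submod k 1≤k) (bk-⊥ {n} k) (bk-⁅⁆ k 1≤k) public

module LSparse {n : ℕ} (l : SetFun n) (l-⊥ : l ⊥ ≡ 0) (l-noninc : Nonincreasing l) (l-super : IntersectingSupermodular l) where

  weight : Subset n → ℕ
  weight A = sumOver A λ v → l ⁅ v ⁆

  bl : Subset n → ℕ
  bl A = weight A ∸ l A

  -- Makes the subtraction in `bl` exact: `l` is nonincreasing, so the value at any single vertex of
  -- `A` already dominates `l A`.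
  l≤weight : ∀ A → l A ≤ weight A
  l≤weight A with nonempty? A
  ... | yes (v , v∈A) = ≤-trans (l-noninc ⁅ v ⁆ A (v , x∈⁅x⁆ v) (λ u∈ → subst (_∈ A) (sym (x∈⁅y⁆⇒x≡y v u∈)) v∈A))
          (sumOver-∈ A (λ v → l ⁅ v ⁆) (∈⇒∈ᵇ v∈A))
  ... | no empty rewrite Empty⇒≡⊥ {A = A} (λ u u∈ → empty (u , u∈)) | l-⊥ = z≤n

  bl-exact : ∀ A → bl A + l A ≡ weight A
  bl-exact A = m∸n+n≡m (l≤weight A)

  bl-submod : ∀ A B → Nonempty (A ∩ B) → bl (A ∩ B) + bl (A ∪ B) ≤ bl A + bl B
  bl-submod A B ne = ≤-from 0 (l-super A B ne) (begin
    bl A + bl B + (l A + l B)                                    ≡⟨ interchange (bl A) (bl B) (l A) (l B) ⟩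
    (bl A + l A) + (bl B + l B)                                  ≡⟨ cong₂ _+_ (bl-exact A) (bl-exact B) ⟩
    weight A + weight B                                          ≡⟨ sumOver-modular A B _ ⟨
    weight (A ∩ B) + weight (A ∪ B)                              ≡⟨ cong₂ _+_ (bl-exact (A ∩ B)) (bl-exact (A ∪ B)) ⟨
    (bl (A ∩ B) + l (A ∩ B)) + (bl (A ∪ B) + l (A ∪ B))          ≡⟨ interchange (bl (A ∩ B)) (bl (A ∪ B)) (l (A ∩ B)) (l (A ∪ B)) ⟨
    bl (A ∩ B) + bl (A ∪ B) + (l (A ∩ B) + l (A ∪ B))            ≡⟨ +-identityʳ _ ⟨
    bl (A ∩ B) + bl (A ∪ B) + (l (A ∩ B) + l (A ∪ B)) + 0        ∎)
    where
    open ≡-Reasoning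
    interchange : ∀ a b c d → a + b + (c + d) ≡ (a + c) + (b + d)
    interchange = solve-∀

  bl-⊥ : bl ⊥ ≡ 0
  bl-⊥ rewrite sumOver-⊥ (λ v → l ⁅ v ⁆) = 0∸n≡0 (l ⊥)

  bl-⁅⁆ : ∀ v → bl ⁅ v ⁆ ≡ 0
  bl-⁅⁆ v rewrite sumOver-⁅⁆ v (λ v → l ⁅ v ⁆) = n∸n≡0 (l ⁅ v ⁆)

  open Sparsity {n * n} {n} (insideEdge {n}) bl
    (λ A B → Nonempty (A ∩ B)) (λ A B → nonempty? (A ∩ B))
    (insideEdge-mono {n}) (insideEdge-∩ {n}) (insideEdge⇒Nonempty {n})
    bl-submod bl-⊥ bl-⁅⁆ public

-- The rank condition

⁅⁆≢⊤ : (u : Fin (suc (suc n))) → ⁅ u ⁆ ≢ ⊤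
⁅⁆≢⊤ {n} u eq with () ← trans (sym (∣⁅x⁆∣≡1 u)) (trans (cong ∣_∣ eq) (∣⊤∣≡n (suc (suc n))))

-- The whole vertex set occurs at most once among separated parts, since `v` would be common to two
-- occurrences; without a vertex, `⊥` and `⊤` coincide and this argument breaks down.
partition-demand : ∀ {n d} (l : SetFun n) → Fin n → (P : Fin d → Subset n) → (∀ x y → Nonempty (P x ∩ P y) → x ≡ y) →
  sum (l ∘ P) ≤ sum (λ y → if ⌊ P y ≟ˢ ⊤ ⌋ then 0 else l (P y)) + l ⊤
partition-demand {n} {d} l v P separated = begin
  sum (l ∘ P)                                      ≤⟨ sum-mono pt ⟩
  sum (λ y → demand y + l ⊤ * 𝟙 ⌊ P y ≟ˢ ⊤ ⌋)      ≡⟨ sum-+ _ _ ⟩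
  sum demand + sum (λ y → l ⊤ * 𝟙 ⌊ P y ≟ˢ ⊤ ⌋)    ≡⟨ cong (sum demand +_) (sum-*ˡ (l ⊤) _) ⟨
  sum demand + l ⊤ * sum (λ y → 𝟙 ⌊ P y ≟ˢ ⊤ ⌋)    ≤⟨ +-monoʳ-≤ (sum demand) (*-monoʳ-≤ (l ⊤) (sum-𝟙-unique (λ y → ⌊ P y ≟ˢ ⊤ ⌋) unique)) ⟩
  sum demand + l ⊤ * 1                             ≡⟨ cong (sum demand +_) (*-identityʳ (l ⊤)) ⟩
  sum demand + l ⊤                                 ∎
  where
  open ≤-Reasoning
  demand : Fin d → ℕ
  demand y = if ⌊ P y ≟ˢ ⊤ ⌋ then 0 else l (P y)
  pt : ∀ y → l (P y) ≤ demand y + l ⊤ * 𝟙 ⌊ P y ≟ˢ ⊤ ⌋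
  pt y with P y ≟ˢ ⊤
  ... | yes eq rewrite eq = ≤-reflexive (sym (*-identityʳ (l ⊤)))
  ... | no _ = m≤m+n _ _
  unique : ∀ x y → ⌊ P x ≟ˢ ⊤ ⌋ ≡ true → ⌊ P y ≟ˢ ⊤ ⌋ ≡ true → x ≡ y
  unique x y p q = separated x y (v , x∈p∩q⁺ (full x p , full y q))
    where
    full : ∀ x → ⌊ P x ≟ˢ ⊤ ⌋ ≡ true → v ∈ P x
    full x p = subst (v ∈_) (sym (⌊⌋-true (P x ≟ˢ ⊤) p)) ∈⊤

count-all : ∀ {n c d} (G : SimpleGraph n) (l : SetFun n) (p k : ℕ) →
  l ⊥ ≡ 0 → Nonincreasing l → 1 ≤ p → 2 ≤ k → Connected4kp k p l G →
  (C : Fin c → Subset n) (P : Fin d → Subset n) →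
  (∀ x y → Nonempty (P x ∩ P y) → x ≡ y) → (∀ v → ∃ λ y → v ∈ P y) →
  (loss : Fin (n * n) → ℕ) →
  (∀ e → edgesOf G e ≡ true → 1 ≤ loss e ⊎ ∃₂ λ x y → insideEdge {n} e (C x ∩ P y) ≡ true) →
  p * bk k (⊤ {n}) + sum (l ∘ P) ≤ p * sum (bk k ∘ C) + sum loss + l ⊤
count-all {zero} G l p k l-⊥ _ 1≤p 2≤k conn C P separated covers loss kept
  rewrite bk-⊥ {zero} k | *-zeroʳ p | sum-zero {f = l ∘ P} (λ y → trans (cong l (Empty⇒≡⊥ λ ())) l-⊥) = z≤n
-- The only vertex is the whole vertex set, so connectivity says nothing; but `bk` vanishes there
-- and no part has a demand.
count-all {suc zero} G l p k l-⊥ _ 1≤p 2≤k conn C P separated covers loss kept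
  rewrite bk-⁅⁆ k (≤-trans (s≤s z≤n) 2≤k) (zero {0}) | *-zeroʳ p =
  ≤-trans (partition-demand l zero P separated) (≤-trans (≤-reflexive (cong (_+ l ⊤) (sum-zero none))) (m≤n+m (l ⊤) _))
  where
  none : ∀ y → (if ⌊ P y ≟ˢ ⊤ ⌋ then 0 else l (P y)) ≡ 0
  none y with P y
  ... | true ∷ [] = refl
  ... | false ∷ [] = l-⊥
count-all {suc (suc n)} G l p k l-⊥ l-noninc 1≤p 2≤k conn C P separated covers loss kept
  with any? (λ x → any? λ y → (C x ∩ P y) ≟ˢ ⊤)
-- Here a member of `C` and a part are both the whole vertex set: the former pays for `bk k ⊤`, and
-- every other part is empty.
... | yes (x , y , eq) = begin
  p * bk k (⊤ {suc (suc n)}) + sum (l ∘ P)                   ≤⟨ +-mono-≤ (*-monoʳ-≤ p ⊤≤) (partition-demand l zero P separated) ⟩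
  p * sum (bk k ∘ C) + (sum demand + l ⊤)    ≡⟨ cong (λ t → p * sum (bk k ∘ C) + (t + l ⊤)) (sum-zero none) ⟩
  p * sum (bk k ∘ C) + l ⊤                   ≤⟨ +-monoˡ-≤ (l ⊤) (m≤m+n _ (sum loss)) ⟩
  p * sum (bk k ∘ C) + sum loss + l ⊤        ∎
  where
  open ≤-Reasoning
  demand = λ y → if ⌊ P y ≟ˢ ⊤ ⌋ then 0 else l (P y)
  C≡⊤ : C x ≡ ⊤
  C≡⊤ = ⊆-antisym ⊆⊤ λ u∈ → p∩q⊆p (C x) (P y) (subst (_ ∈_) (sym eq) u∈)
  P≡⊤ : P y ≡ ⊤
  P≡⊤ = ⊆-antisym ⊆⊤ λ u∈ → p∩q⊆q (C x) (P y) (subst (_ ∈_) (sym eq) u∈)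
  ⊤≤ : bk k (⊤ {suc (suc n)}) ≤ sum (bk k ∘ C)
  ⊤≤ = subst (λ t → bk k t ≤ sum (bk k ∘ C)) C≡⊤ (≤-sum (bk k ∘ C) x)
  none : ∀ y′ → demand y′ ≡ 0
  none y′ with P y′ ≟ˢ ⊤
  ... | yes _ = refl
  ... | no P≢⊤ = trans (cong l (Empty⇒≡⊥ λ u u∈ → P≢⊤ (trans (cong P (separated y′ y
          (u , x∈p∩q⁺ (u∈ , subst (u ∈_) (sym P≡⊤) ∈⊤)))) P≡⊤))) l-⊥
-- `Count.count` reaches p k n, which is at least p times `bk k ⊤`.
... | no proper = begin
  p * bk k (⊤ {N}) + sum (l ∘ P)
    ≤⟨ +-mono-≤ (≤-trans (*-monoʳ-≤ p (m∸n≤m (k * ∣ ⊤ {N} ∣) (k + k ∸ 1))) (≤-reflexive (trans (sym (*-assoc p k ∣ ⊤ {N} ∣)) (cong (p * k *_) (∣⊤∣≡n N)))))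
         (partition-demand l zero P separated) ⟩
  p * k * N + (sum demand + l ⊤)
    ≡⟨ +-assoc (p * k * N) _ _ ⟨
  p * k * N + sum demand + l ⊤
    ≤⟨ +-monoˡ-≤ (l ⊤) (*-cancelˡ-≤ 2 (Count.count G l p k l-⊥ l-noninc 1≤p 2≤k conn C P separated covers ⁅⁆≢⊤
         (λ x y eq → proper (x , y , eq)) loss kept)) ⟩
  p * sum (bk k ∘ C) + sum loss + l ⊤ ∎
  where
  open ≤-Reasoning
  N = suc (suc n)
  demand = λ y → if ⌊ P y ≟ˢ ⊤ ⌋ then 0 else l (P y)

-- Edge sets as graphs

graphOf : (Fin (n * n) → Bool) → SimpleGraph n
graphOf {n} J = record
  { adj = λ i j → directed i j ∨ directed j i
  ; sym = λ i j → Bool.∨-comm (directed i j) (directed j i)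
  ; irrefl = λ i → cong₂ _∨_ (loop i) (loop i)
  }
  where
  directed : Fin n → Fin n → Bool
  directed i j = ⌊ toℕ i <? toℕ j ⌋ ∧ J (combine i j)
  loop : ∀ i → directed i i ≡ false
  loop i with toℕ i <? toℕ i
  ... | yes i<i = contradiction i<i (<-irrefl refl)
  ... | no _ = refl

graphOf-adj : (J : Fin (n * n) → Bool) (i j : Fin n) → adj (graphOf {n} J) i j ≡ true →
  (toℕ i < toℕ j × J (combine i j) ≡ true) ⊎ (toℕ j < toℕ i × J (combine j i) ≡ true)
graphOf-adj J i j h with toℕ i <? toℕ j | toℕ j <? toℕ i
... | yes i<j | yes j<i = contradiction j<i (<-asym i<j)
... | yes i<j | no _ = inj₁ (i<j , trans (sym (Bool.∨-identityʳ _)) h)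
... | no _ | yes j<i = inj₂ (j<i , h)

edgesOf-combine : (G : SimpleGraph n) (i j : Fin n) → edgesOf G (combine i j) ≡ true → adj G i j ≡ true
edgesOf-combine {n} G i j h =
  subst (λ ij → adj G (proj₁ ij) (proj₂ ij) ≡ true) (remQuot-combine i j) (∧-snd {ascending {n} (combine i j)} h)

graphOf-⊑ : (G : SimpleGraph n) (J : Fin (n * n) → Bool) → (∀ e → J e ≡ true → edgesOf G e ≡ true) → graphOf {n} J ⊑ G
graphOf-⊑ {n} G J J⊆E i j h with graphOf-adj {n} J i j h
... | inj₁ (_ , Jij) = edgesOf-combine G i j (J⊆E _ Jij)
... | inj₂ (_ , Jji) = trans (adj-sym G i j) (edgesOf-combine G j i (J⊆E _ Jji))

graphOf-disjoint : (I J : Fin (n * n) → Bool) → (∀ e → I e ≡ true → ¬ J e ≡ true) → EdgeDisjoint (graphOf {n} I) (graphOf {n} J)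
graphOf-disjoint {n} I J disjoint i j h = ¬-not disagree
  where
  disagree : ¬ adj (graphOf {n} J) i j ≡ true
  disagree h′ with graphOf-adj {n} I i j h | graphOf-adj {n} J i j h′
  ... | inj₁ (_ , p) | inj₁ (_ , q) = disjoint _ p q
  ... | inj₂ (_ , p) | inj₂ (_ , q) = disjoint _ p q
  ... | inj₁ (i<j , _) | inj₂ (j<i , _) = <-asym i<j j<i
  ... | inj₂ (j<i , _) | inj₁ (i<j , _) = <-asym i<j j<i

graphOf-ascending : (J : Fin (n * n) → Bool) (e : Fin (n * n)) → ascending {n} e ≡ true →
  adj (graphOf {n} J) (src {n} e) (tgt {n} e) ≡ J e
graphOf-ascending {n} J e asc with toℕ (src {n} e) <? toℕ (tgt {n} e) | toℕ (tgt {n} e) <? toℕ (src {n} e)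
... | yes s<t | yes t<s = contradiction t<s (<-asym s<t)
... | yes _ | no _ = trans (Bool.∨-identityʳ _) (cong J (combine-remQuot {n} n e))

guard : ∀ a {x y q} → (a ≡ true → x ≡ y) → (y ≡ true → a ≡ true) → a ∧ (x ∧ q) ≡ y ∧ q
guard true {q = q} x≡y _ = cong (_∧ q) (x≡y refl)
guard false {y = false} _ _ = refl
guard false {y = true} _ h with () ← h refl

graphOf-count : (J : Fin (n * n) → Bool) (Q : Fin n → Fin n → Bool) → (∀ e → J e ≡ true → ascending {n} e ≡ true) →
  countPairs (λ i j → adj (graphOf {n} J) i j ∧ Q i j) ≡ cnt (λ e → J e ∧ Q (src {n} e) (tgt {n} e))
graphOf-count {n} J Q asc = trans (countPairs≡cnt {n} _) (sum-cong λ e → cong 𝟙 (pt e))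
  where
  pt : ∀ e → ascending {n} e ∧ (adj (graphOf {n} J) (src {n} e) (tgt {n} e) ∧ Q (src {n} e) (tgt {n} e))
    ≡ J e ∧ Q (src {n} e) (tgt {n} e)
  pt e = guard (ascending {n} e) (graphOf-ascending {n} J e) (asc e)

module _ {n : ℕ} (J : Fin (n * n) → Bool) (asc : ∀ e → J e ≡ true → ascending {n} e ≡ true) where

  graphOf-eIn : ∀ A → eIn (graphOf {n} J) A ≡ cnt (λ e → J e ∧ insideEdge {n} e A)
  graphOf-eIn A = trans (graphOf-count {n} J _ asc) (sum-cong λ e → cong 𝟙 (pt e))
    where
    pt : ∀ e → J e ∧ (src {n} e ∈ᵇ A ∧ tgt {n} e ∈ᵇ A) ≡ J e ∧ insideEdge {n} e A
    pt e with J e in Je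
    ... | false = refl
    ... | true rewrite asc e Je = refl

  graphOf-numEdges : numEdges (graphOf {n} J) ≡ cnt J
  graphOf-numEdges = begin
    countPairs (adj (graphOf {n} J))                          ≡⟨ countPairs≡cnt {n} (adj (graphOf {n} J)) ⟩
    cnt (λ e → ascending {n} e ∧ adj (graphOf {n} J) (src {n} e) (tgt {n} e))
                                                              ≡⟨ sum-cong (λ e → cong (λ t → 𝟙 (ascending {n} e ∧ t)) (sym (Bool.∧-identityʳ _))) ⟩
    cnt (λ e → ascending {n} e ∧ (adj (graphOf {n} J) (src {n} e) (tgt {n} e) ∧ true))
                                                              ≡⟨ countPairs≡cnt {n} (λ i j → adj (graphOf {n} J) i j ∧ true) ⟨
    countPairs (λ i j → adj (graphOf {n} J) i j ∧ true)       ≡⟨ graphOf-count {n} J (λ _ _ → true) asc ⟩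
    cnt (λ e → J e ∧ true)                                    ≡⟨ sum-cong (λ e → cong 𝟙 (Bool.∧-identityʳ (J e))) ⟩
    cnt J                                                     ∎
    where open ≡-Reasoning

  cnt≤within-⊤ : cnt J ≤ cnt (λ e → J e ∧ insideEdge {n} e ⊤)
  cnt≤within-⊤ = cnt-mono λ e Je → ∧-intro Je (∧-intro (asc e Je) (∧-intro (∈ᵇ-⊤ (src {n} e)) (∈ᵇ-⊤ (tgt {n} e))))

  part-count : (P : Partition n) →
    cnt J ≤ eCross (graphOf {n} J) P + sum (λ c → cnt (λ e → J e ∧ insideEdge {n} e (part P c)))
  part-count P = begin
    cnt J
      ≤⟨ sum-mono pt ⟩
    sum (λ e → 𝟙 (J e ∧ not ⌊ block P (src {n} e) ≟ block P (tgt {n} e) ⌋) + sum (λ c → 𝟙 (J e ∧ insideEdge {n} e (part P c))))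
      ≡⟨ trans (sum-+ _ _) (cong₂ _+_ (sym (graphOf-count {n} J (λ i j → not ⌊ block P i ≟ block P j ⌋) asc)) (sum-swap _)) ⟩
    eCross (graphOf {n} J) P + sum (λ c → cnt (λ e → J e ∧ insideEdge {n} e (part P c))) ∎
    where
    open ≤-Reasoning
    pt : ∀ e → 𝟙 (J e) ≤ 𝟙 (J e ∧ not ⌊ block P (src {n} e) ≟ block P (tgt {n} e) ⌋) + sum (λ c → 𝟙 (J e ∧ insideEdge {n} e (part P c)))
    pt e with J e in Je
    ... | false = z≤n
    ... | true with block P (src {n} e) ≟ block P (tgt {n} e)
    ...   | no _ = s≤s z≤n
    ...   | yes eq = subst (_≤ sum λ c → 𝟙 (insideEdge {n} e (part P c))) (cong 𝟙 same) (≤-sum _ (block P (src {n} e)))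
      where
      in-part : ∀ v c → block P v ≡ c → v ∈ᵇ part P c ≡ true
      in-part v c eq = trans (lookup∘tabulate _ v) (⌊⌋-true⁺ (block P v ≟ c) eq)
      same : insideEdge {n} e (part P (block P (src {n} e))) ≡ true
      same = ∧-intro (asc e Je) (∧-intro (in-part (src {n} e) _ refl) (in-part (tgt {n} e) _ (sym eq)))

-- Spanning sparse edge sets

ℓk-⁅⁆ : ∀ k (v : Fin n) → ℓk k ⁅ v ⁆ ≡ k
ℓk-⁅⁆ k v rewrite ∣⁅x⁆∣≡1 v = refl

sumSingletons-ℓk : ∀ k (A : Subset n) → sumSingletons (ℓk k) A ≡ k * ∣ A ∣
sumSingletons-ℓk k A = trans (sym (sum≡Σᶠ _)) (trans (sum-cong λ v → cong (if v ∈ᵇ A then_else 0) (ℓk-⁅⁆ k v)) (sumOver-const A k))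

bk+ℓk : ∀ k → 1 ≤ k → (A : Subset n) → bk k A + ℓk k A ≡ k * ∣ A ∣
bk+ℓk k 1≤k A with ∣ A ∣ in eq
... | zero rewrite *-zeroʳ k | 0∸n≡0 (k + k ∸ 1) = refl
... | suc zero rewrite *-identityʳ k | m≤n⇒m∸n≡0 {k} {k + k ∸ 1} (k≤k+k∸1 1≤k) = refl
... | suc (suc a) = subst (λ t → k * t ∸ (k + k ∸ 1) + (k + k ∸ 1) ≡ k * t) eq
      (bk-exact k A 1≤k (subst (2 ≤_) (sym eq) (s≤s (s≤s z≤n))))

k-rigid : ∀ {n} k → 1 ≤ k → (J : Fin (n * n) → Bool) → (∀ e → J e ≡ true → ascending {n} e ≡ true) →
  (∀ A → cnt (λ e → J e ∧ insideEdge {n} e A) ≤ bk k A) → bk k (⊤ {n}) ≤ cnt J → KRigid k (graphOf {n} J)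
k-rigid {n} k 1≤k J asc indep spanning = graphOf {n} J , (λ _ _ p → p) , sparse , total
  where
  sparse : Sparse (ℓk k) (graphOf {n} J)
  sparse A = begin
    eIn (graphOf {n} J) A + ℓk k A  ≡⟨ cong (_+ ℓk k A) (graphOf-eIn {n} J asc A) ⟩
    cnt (λ e → J e ∧ insideEdge {n} e A) + ℓk k A  ≤⟨ +-monoˡ-≤ (ℓk k A) (indep A) ⟩
    bk k A + ℓk k A                 ≡⟨ trans (bk+ℓk k 1≤k A) (sym (sumSingletons-ℓk k A)) ⟩
    sumSingletons (ℓk k) A          ∎
    where open ≤-Reasoning
  total : numEdges (graphOf {n} J) + ℓk k (⊤ {n}) ≡ sumSingletons (ℓk k) (⊤ {n})
  total = begin
    numEdges (graphOf {n} J) + ℓk k (⊤ {n})  ≡⟨ cong (_+ ℓk k (⊤ {n})) (graphOf-numEdges {n} J asc) ⟩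
    cnt J + ℓk k (⊤ {n})                     ≡⟨ cong (_+ ℓk k (⊤ {n})) (≤-antisym (≤-trans (cnt≤within-⊤ J asc) (indep (⊤ {n}))) spanning) ⟩
    bk k (⊤ {n}) + ℓk k (⊤ {n})              ≡⟨ trans (bk+ℓk k 1≤k (⊤ {n})) (sym (sumSingletons-ℓk k (⊤ {n}))) ⟩
    sumSingletons (ℓk k) (⊤ {n})             ∎
    where open ≡-Reasoning

-- The rank condition for the matroid union, and the packing it yields

module Packing {n : ℕ} (G : SimpleGraph n) (l : SetFun n) (p k : ℕ)
  (l-⊥ : l ⊥ ≡ 0) (l-noninc : Nonincreasing l) (l-super : IntersectingSupermodular l)
  (1≤p : 1 ≤ p) (2≤k : 2 ≤ k) (conn : Connected4kp k p l G)
  where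

  1≤k : 1 ≤ k
  1≤k = ≤-trans (s≤s z≤n) 2≤k

  module L = LSparse l l-⊥ l-noninc l-super
  module K = KSparse n k 1≤k

  -- A sparse set has at most `bl` edges inside each part, and these bounds add up to the total
  -- weight minus the sum of `l` over the parts. Since `J` has the total weight minus `l ⊤` edges,
  -- the remaining ones must cross.
  partition-connected : (J : Fin (n * n) → Bool) → (∀ e → J e ≡ true → ascending {n} e ≡ true) →
    L.Indep J → L.bl ⊤ ≤ cnt J → PartitionConnected l (graphOf {n} J)
  partition-connected J asc indep spanning P = begin
    Σᶠ (λ c → l (part P c))                    ≡⟨ sum≡Σᶠ _ ⟨
    sum (λ c → l (part P c))                   ≤⟨ ≤-from 0 (+-mono-≤ parts (part-count {n} J asc P)) (ring (eCross (graphOf {n} J) P) (sum λ c → l (part P c)) (sum λ c → L.within J (part P c)) (cnt J) (l ⊤)) ⟩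
    eCross (graphOf {n} J) P + l ⊤             ∎
    where
    open ≤-Reasoning
    ring : ∀ x s w j t → x + t + ((w + s) + j) ≡ s + (j + t + (x + w)) + 0
    ring = solve-∀
    in-part : ∀ v c → v ∈ᵇ part P c ≡ true → block P v ≡ c
    in-part v c h = ⌊⌋-true (block P v ≟ c) (trans (sym (lookup∘tabulate _ v)) h)
    once : ∀ v → multiplicity (part P) v ≤ 1
    once v = multiplicity≤1 (part P) v λ c c′ h h′ → trans (sym (in-part v c h)) (in-part v c′ h′)
    parts : sum (λ c → L.within J (part P c)) + sum (λ c → l (part P c)) ≤ cnt J + l ⊤
    parts = begin
      sum (λ c → L.within J (part P c)) + sum (λ c → l (part P c))
        ≡⟨ sum-+ _ _ ⟨
      sum (λ c → L.within J (part P c) + l (part P c))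
        ≤⟨ sum-mono (λ c → ≤-trans (+-monoˡ-≤ (l (part P c)) (indep (part P c))) (≤-reflexive (L.bl-exact (part P c)))) ⟩
      sum (λ c → L.weight (part P c))
        ≡⟨ double-count (part P) (λ v → l ⁅ v ⁆) ⟩
      sum (λ v → multiplicity (part P) v * l ⁅ v ⁆)
        ≤⟨ sum-mono (λ v → ≤-trans (*-monoˡ-≤ (l ⁅ v ⁆) (once v)) (≤-reflexive (*-identityˡ _))) ⟩
      sum (λ v → l ⁅ v ⁆)
        ≡⟨ trans (sym (sumOver-⊤ _)) (sym (L.bl-exact ⊤)) ⟩
      L.bl ⊤ + l ⊤
        ≤⟨ +-monoˡ-≤ (l ⊤) spanning ⟩
      cnt J + l ⊤ ∎

  E : Fin (n * n) → Bool
  E = edgesOf G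

  -- The three ways in which an edge is counted individually: outside `R`, or in `R` but missed by
  -- `C`, or in `R` but missed by `P`. An edge of `R` missed by both counts twice.
  loss : ∀ {c d} → (Fin (n * n) → Bool) → (Fin c → Subset n) → (Fin d → Subset n) → Fin (n * n) → ℕ
  loss R C P e = 𝟙 (E e ∧ not (R e)) + 𝟙 (K.uncovered (λ e → E e ∧ R e) C e) + 𝟙 (L.uncovered (λ e → E e ∧ R e) P e)

  loss-kept : ∀ {c d} R (C : Fin c → Subset n) (P : Fin d → Subset n) e → E e ≡ true →
    1 ≤ loss R C P e ⊎ ∃₂ λ x y → insideEdge {n} e (C x ∩ P y) ≡ true
  loss-kept R C P e Ee with E e | R e
  loss-kept R C P e () | false | _
  ... | true | false = inj₁ (s≤s z≤n)
  ... | true | true with any? (λ x → insideEdge {n} e (C x) Bool.≟ true)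
  ...   | no _ = inj₁ (s≤s z≤n)
  ...   | yes (x , h) with any? (λ y → insideEdge {n} e (P y) Bool.≟ true)
  ...     | no _ = inj₁ (s≤s z≤n)
  ...     | yes (y , h′) = inj₂ (x , y , insideEdge-∩ {n} e (C x) (P y) h h′)

  -- Separation here means disjointness, so the cover is a partition up to empty members and both
  -- sides equal the sum of `l` over the single vertices.
  partition-weight : ∀ {d} (P : Fin d → Subset n) → (∀ x y → Nonempty (P x ∩ P y) → x ≡ y) → (∀ v → ∃ λ y → v ∈ P y) →
    sum (L.bl ∘ P) + sum (l ∘ P) ≡ L.bl ⊤ + l ⊤
  partition-weight P separated covers = begin
    sum (L.bl ∘ P) + sum (l ∘ P)                  ≡⟨ sum-+ _ _ ⟨
    sum (λ y → L.bl (P y) + l (P y))              ≡⟨ sum-cong (λ y → L.bl-exact (P y)) ⟩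
    sum (λ y → L.weight (P y))                    ≡⟨ double-count P (λ v → l ⁅ v ⁆) ⟩
    sum (λ v → multiplicity P v * l ⁅ v ⁆)        ≡⟨ sum-cong (λ v → trans (cong (_* l ⁅ v ⁆) (once v)) (*-identityˡ _)) ⟩
    sum (λ v → l ⁅ v ⁆)                           ≡⟨ trans (sym (sumOver-⊤ _)) (sym (L.bl-exact ⊤)) ⟩
    L.bl ⊤ + l ⊤                                  ∎
    where
    open ≡-Reasoning
    once : ∀ v → multiplicity P v ≡ 1
    once v = let y , v∈P = covers v in ≤-antisym
      (multiplicity≤1 P v λ x y h h′ → separated x y (v , x∈p∩q⁺ (∈ᵇ⇒∈ h , ∈ᵇ⇒∈ h′)))
      (1≤multiplicity P v y (∈⇒∈ᵇ v∈P))

  -- Letters: `o` counts edges outside `R`, `uk` and `ul` those missed by the two covers, `rk` and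
  -- `rl` the base sizes. The loss has `uk` once while p copies of the base supply it p times; p >=
  -- 1 bridges the gap.
  combine-bounds : ∀ p {bl⊤ bk⊤ l⊤ sl sb sc o uk ul rl rk s} → 1 ≤ p → s ≡ o + uk + ul → sb + sl ≡ bl⊤ + l⊤ →
    p * bk⊤ + sl ≤ p * sc + s + l⊤ → sb + ul ≤ rl → sc + uk ≤ rk →
    bl⊤ + p * bk⊤ ≤ o + (rl + p * rk)
  combine-bounds p {bl⊤} {bk⊤} {l⊤} {sl} {sb} {sc} {o} {uk} {ul} {rl} {rk} 1≤p refl weights counted hl hk = ≤-from 0
    (+-mono-≤ (+-mono-≤ counted hl) (+-mono-≤ (*-monoʳ-≤ p hk) (*-monoˡ-≤ uk 1≤p)))
    (trans (ring₁ p bk⊤ sl sb sc o uk ul rl rk) (trans (cong (_+ (o + rl + p * rk + p * bk⊤ + ul + p * (sc + uk) + uk)) weights)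
      (ring₂ p bl⊤ bk⊤ l⊤ sc o uk ul rl rk)))
    where
    ring₁ : ∀ p bk⊤ sl sb sc o uk ul rl rk →
      o + (rl + p * rk) + (p * bk⊤ + sl + (sb + ul) + (p * (sc + uk) + 1 * uk))
        ≡ (sb + sl) + (o + rl + p * rk + p * bk⊤ + ul + p * (sc + uk) + uk)
    ring₁ = solve-∀
    ring₂ : ∀ p bl⊤ bk⊤ l⊤ sc o uk ul rl rk →
      (bl⊤ + l⊤) + (o + rl + p * rk + p * bk⊤ + ul + p * (sc + uk) + uk)
        ≡ bl⊤ + p * bk⊤ + (p * sc + (o + uk + ul) + l⊤ + rl + (p * rk + p * uk)) + 0
    ring₂ = solve-∀

  cover-condition : ∀ R {I J} → let S = λ e → E e ∧ R e in (cl : L.Cover S I) (ck : K.Cover S J) →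
    (∀ e → I e ≡ true → S e ≡ true) → (∀ e → J e ≡ true → S e ≡ true) →
    L.bl ⊤ + p * bk k (⊤ {n}) ≤ cnt (λ e → E e ∧ not (R e)) + (cnt I + p * cnt J)
  cover-condition R cl ck I⊆S J⊆S = combine-bounds p 1≤p
    (trans (sum-+ _ _) (cong (_+ cnt (L.uncovered (λ e → E e ∧ R e) P)) (sum-+ _ _)))
    (partition-weight P (L.Cover.separated cl) (L.Cover.covers-vertex cl))
    (count-all G l p k l-⊥ l-noninc 1≤p 2≤k conn C P (L.Cover.separated cl) (L.Cover.covers-vertex cl)
      (loss R C P) (loss-kept R C P))
    (L.cover-lower cl I⊆S) (K.cover-lower ck J⊆S)
    where
    P = L.Cover.piece cl
    C = K.Cover.piece ck

  -- One base of each kind is enough, and a single (k, 2k-1)-cover serves all p copies; only the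
  -- lower bounds that covers give on the ranks are used.
  rank-condition : (R : Fin (n * n) → Bool) → let S = λ e → E e ∧ R e in
    L.bl ⊤ + p * bk k (⊤ {n}) ≤ cnt (λ e → E e ∧ not (R e)) + (L.rank S + p * K.rank S)
  rank-condition R = cover-condition R
    (L.cover (L.Base.indep bL) (L.Base.maximal bL)) (K.cover (K.Base.indep bK) (K.Base.maximal bK))
    (L.Base.subset bL) (K.Base.subset bK)
    where
    bL = L.base λ e → E e ∧ R e
    bK = K.base λ e → E e ∧ R e

  rank : Fin (suc p) → (Fin (n * n) → Bool) → ℕ
  rank zero = L.rank
  rank (suc _) = K.rank

  rank-mono : ∀ i {S T} → (∀ e → S e ≡ true → T e ≡ true) → rank i S ≤ rank i T
  rank-mono zero = L.rank-mono
  rank-mono (suc _) = K.rank-mono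

  rank-submod : ∀ i S T → rank i (λ e → S e ∨ T e) + rank i (λ e → S e ∧ T e) ≤ rank i S + rank i T
  rank-submod zero = L.rank-submod
  rank-submod (suc _) = K.rank-submod

  full : Fin (suc p) → ℕ
  full zero = L.bl ⊤
  full (suc _) = bk k (⊤ {n})

  sum-full : sum full ≡ L.bl ⊤ + p * bk k (⊤ {n})
  sum-full = trans (sum-cons full) (cong (L.bl ⊤ +_) (sum-const p _))

  open Union rank rank-mono rank-submod E (L.bl ⊤ + p * bk k (⊤ {n})) using (disjoint-spanning)

  spanning = disjoint-spanning λ R → ≤-trans (rank-condition R)
    (≤-reflexive (cong (cnt (λ e → E e ∧ not (R e)) +_) (sym (trans (sum-cons (λ i → rank i (λ e → E e ∧ R e))) (cong (L.rank (λ e → E e ∧ R e) +_) (sum-const p _))))))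

  a : Fin (suc p) → Fin (n * n) → Bool
  a = proj₁ spanning

  J : Fin (suc p) → Fin (n * n) → Bool
  J zero = L.Base.set (L.base (a zero))
  J (suc i) = K.Base.set (K.base (a (suc i)))

  J⊆a : ∀ i e → J i e ≡ true → a i e ≡ true
  J⊆a zero = L.Base.subset (L.base (a zero))
  J⊆a (suc i) = K.Base.subset (K.base (a (suc i)))

  J⊆E : ∀ i e → J i e ≡ true → E e ≡ true
  J⊆E i e h = proj₁ (proj₂ spanning) i e (J⊆a i e h)

  J-ascending : ∀ i e → J i e ≡ true → ascending {n} e ≡ true
  J-ascending i e h = ∧-fst {ascending {n} e} (J⊆E i e h)

  cntJ : ∀ i → cnt (J i) ≡ rank i (a i)
  cntJ zero = refl
  cntJ (suc i) = refl

  cntJ≤full : ∀ i → cnt (J i) ≤ full i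
  cntJ≤full zero = ≤-trans (cnt≤within-⊤ {n} (J zero) (J-ascending zero)) (L.Base.indep (L.base (a zero)) ⊤)
  cntJ≤full (suc i) = ≤-trans (cnt≤within-⊤ {n} (J (suc i)) (J-ascending (suc i))) (K.Base.indep (K.base (a (suc i))) ⊤)

  -- The union argument controls only the total size of the bases; as no base exceeds its full rank,
  -- none can fall short of it.
  full≤cntJ : ∀ i → full i ≤ cnt (J i)
  full≤cntJ = sum-squeeze cntJ≤full (begin
    sum full                      ≡⟨ sum-full ⟩
    L.bl ⊤ + p * bk k (⊤ {n})     ≤⟨ proj₂ (proj₂ (proj₂ spanning)) ⟩
    sum (λ i → rank i (a i))      ≡⟨ sum-cong cntJ ⟨
    sum (λ i → cnt (J i))         ∎)
    where open ≤-Reasoning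

theorem1p4 : ∀ {n} (G : SimpleGraph n) (l : SetFun n) (p k : ℕ) →
    l ⊥ ≡ 0 → Nonincreasing l → IntersectingSupermodular l →
    1 ≤ p → 2 ≤ k →
    Connected4kp k p l G →
    Σ (Fin (suc p) → SimpleGraph n) λ H →
    (∀ a → H a ⊑ G) ×
    (∀ a b → a ≢ b → EdgeDisjoint (H a) (H b)) ×
    PartitionConnected l (H zero) ×
    (∀ (i : Fin p) → KRigid k (H (suc i)))
theorem1p4 {n} G l p k l-⊥ l-noninc l-super 1≤p 2≤k conn =
    (λ i → graphOf {n} (J i))
  , (λ i → graphOf-⊑ {n} G (J i) (J⊆E i))
  , (λ i j i≢j → graphOf-disjoint {n} (J i) (J j) λ e p q →
      i≢j (proj₁ (proj₂ (proj₂ spanning)) i j e (J⊆a i e p) (J⊆a j e q)))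
  , partition-connected (J zero) (J-ascending zero) (L.Base.indep (L.base (a zero))) (full≤cntJ zero)
  , λ i → k-rigid {n} k 1≤k (J (suc i)) (J-ascending (suc i)) (K.Base.indep (K.base (a (suc i)))) (full≤cntJ (suc i))
  where open Packing G l p k l-⊥ l-noninc l-super 1≤p 2≤k conn
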